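{- Let $d\ge 3$ be a fixed integer and let $G\in\mathcal{G}(n,d)$ be a random $d$-regular graph on $n$ vertices (with $dn$ even). Then a.a.s. $G$ has linear tree-width and linear tree-depth; that is, there is a constant $\eta=\eta(d)>0$ such that $$\Pr\left(\operatorname{tw}(G)\ge \eta n \text{ and } \operatorname{td}(G)\ge\eta n\right)\to 1$$ as $n\to\infty$ along integers $n$ with $dn$ even. (The upper bounds $\operatorname{tw}(G)\le n$ and $\operatorname{td}(G)\le n$ always hold.)
   Context: $\mathcal{G}(n,d)$ is the configuration model of random $d$-regular graphs: to each of $n$ labeled vertices attach $d$ half-edges, choose a uniformly random perfect matching of the $dn$ half-edges, and let each matched pair form an edge between the corresponding vertices. The outcome may have loops and multiple edges; the tree-width and tree-depth are those of the underlying simple graph. A.a.s. (asymptotically almost surely) means with probability tending to $1$ as $n\to\infty$. $\operatorname{tw}(G)$ denotes the usual tree-width of $G$. Tree-depth: the closure of a rooted tree $T$ is the graph on the vertex set of $T$ in which two distinct vertices are adjacent iff one is an ancestor of the other in $T$. A rooted forest is a disjoint union of rooted trees, and its closure is the disjoint union of the closures of its trees. The height of a rooted tree is the maximum number of vertices on a path from the root to a vertex, and the height of a rooted forest is the maximum height of its trees. The tree-depth $\operatorname{td}(G)$ of a graph $G$ is the minimum height of a rooted forest $F$ on the vertex set $V(G)$ such that $G$ is a subgraph of the closure of $F$. (With this convention $\operatorname{td}(K_n)=n$.) -}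

module Defs where

open import Level using (0ℓ)
open import Data.Nat.Base as ℕ using (ℕ; zero; suc; _⊔_; _∸_)
open import Data.Integer.Base using (+_)
open import Data.Rational.Base using (ℚ; _/_; _*_; _-_; _≤_; _<_; 0ℚ; 1ℚ)
open import Data.Fin.Base as Fin using (Fin; inject₁; fromℕ; quotient)
open import Data.Fin.Properties as Fin using (any?; all?)
open import Data.Fin.Subset using (Subset; _∈_; ∣_∣)
open import Data.Vec.Base using (Vec; []; _∷_; lookup)
import Data.Vec.Functional as F
open import Data.List.Base using (List; [_]; length; allFin; cartesianProductWith; mapMaybe)
open import Data.List.Relation.Unary.All using (All)
open import Data.List.Relation.Binary.Sublist.Propositional using (_⊆_)
open import Data.Maybe.Base using (Maybe; just; nothing; map)
open import Data.Product.Base using (Σ; ∃; ∃-syntax; _×_; _,_; proj₁; proj₂)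
open import Data.Sum.Base using (_⊎_)
open import Function.Definitions using (Injective)
open import Relation.Binary.Core using (Rel)
open import Relation.Binary.Definitions using (Decidable; Symmetric; Irreflexive)
open import Relation.Binary.Construct.Closure.ReflexiveTransitive using (Star)
open import Relation.Binary.PropositionalEquality
  using (_≡_; _≢_; refl; sym; trans; cong; ≢-sym)
open import Relation.Nullary.Decidable using (Dec; ¬?; _×-dec_; dec⇒maybe)
open import Relation.Nullary.Negation using (¬_)

ℕtoℚ : ℕ → ℚ
ℕtoℚ k = + k / 1

maximum : ∀ {m} → (Fin m → ℕ) → ℕ
maximum = F.foldr _⊔_ 0

------------------------------------------------------------------------
-- Graphs and trees

record SimpleGraph (n : ℕ) : Set₁ where
  field
    Adj    : Rel (Fin n) 0ℓ
    adj?   : Decidable Adj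
    symm   : Symmetric Adj
    irrefl : Irreflexive _≡_ Adj

open SimpleGraph public

-- The subgraph induced on P is connected (vacuously so if P is empty).
ConnectedOn : ∀ {n} → SimpleGraph n → (Fin n → Set) → Set
ConnectedOn G P =
  ∀ s t → P s → P t → Star (λ a b → P a × P b × Adj G a b) s t

Connected : ∀ {n} → SimpleGraph n → Set
Connected G = ∀ s t → Star (Adj G) s t

-- The cycle c 0, c 1, …, c (k + 2), c 0 of length k + 3.
record Cycle {n} (G : SimpleGraph n) : Set where
  field
    {k}      : ℕ
    c        : Fin (3 ℕ.+ k) → Fin n
    distinct : Injective _≡_ _≡_ c
    steps    : ∀ i → Adj G (c (inject₁ i)) (c (Fin.suc i))
    closes   : Adj G (c (fromℕ (2 ℕ.+ k))) (c Fin.zero)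

IsTree : ∀ {n} → SimpleGraph n → Set
IsTree G = Connected G × ¬ Cycle G

------------------------------------------------------------------------
-- Tree-width

record TreeDecomposition {n} (G : SimpleGraph n) : Set₁ where
  field
    {m}        : ℕ
    tree       : SimpleGraph (suc m)
    isTree     : IsTree tree
    bag        : Fin (suc m) → Subset n
    coversV    : ∀ v → ∃[ t ] v ∈ bag t
    coversE    : ∀ u v → Adj G u v → ∃[ t ] (u ∈ bag t × v ∈ bag t)
    coherent   : ∀ v → ConnectedOn tree (λ t → v ∈ bag t)

  -- Truncated subtraction matters only for the graph with no vertices.
  width : ℕ
  width = maximum (λ t → ∣ bag t ∣) ∸ 1

open TreeDecomposition public using (width)

-- tw(G) is the least width of a tree decomposition of G.  So tw(G) ≥ x
-- says that x bounds all widths from below, and tw(G) ≤ k that some width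
-- is at most k.
tw[_]≥_ : ∀ {n} → SimpleGraph n → ℚ → Set₁
tw[ G ]≥ x = (D : TreeDecomposition G) → x ≤ ℕtoℚ (width D)

tw[_]≤_ : ∀ {n} → SimpleGraph n → ℕ → Set₁
tw[ G ]≤ k = Σ (TreeDecomposition G) λ D → width D ℕ.≤ k

------------------------------------------------------------------------
-- Tree-depth

-- The roots are the vertices without a parent.  The field depth gives the
-- number of vertices on the path from the root to a vertex; such a function
-- exists precisely when following parents never runs into a cycle, and it
-- is then unique.
record RootedForest (n : ℕ) : Set where
  field
    parent     : Fin n → Maybe (Fin n)
    depth      : Fin n → ℕ
    depth-root : ∀ v → parent v ≡ nothing → depth v ≡ 1
    depth-step : ∀ v u → parent v ≡ just u → depth v ≡ suc (depth u)

  -- u Ancestor v: u lies on the path from the root to v.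
  Ancestor : Rel (Fin n) 0ℓ
  Ancestor = Star (λ u v → parent v ≡ just u)

  ClosureAdj : Rel (Fin n) 0ℓ
  ClosureAdj u v = u ≢ v × (Ancestor u v ⊎ Ancestor v u)

  height : ℕ
  height = maximum depth

open RootedForest public using (ClosureAdj; height)

_⊆closure_ : ∀ {n} → SimpleGraph n → RootedForest n → Set
G ⊆closure F = ∀ u v → Adj G u v → ClosureAdj F u v

-- As for tree-width, td(G) being the least height of a rooted forest on
-- V(G) whose closure contains G.
td[_]≥_ : ∀ {n} → SimpleGraph n → ℚ → Set
td[ G ]≥ x = (F : RootedForest _) → G ⊆closure F → x ≤ ℕtoℚ (height F)

td[_]≤_ : ∀ {n} → SimpleGraph n → ℕ → Set
td[ G ]≤ k = Σ (RootedForest _) λ F → G ⊆closure F × height F ℕ.≤ k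

------------------------------------------------------------------------
-- The configuration model

-- A perfect matching of m points, as the map sending each point to its
-- partner: an involution without fixed points.  Such maps are stored as
-- vectors, so that each matching is represented by exactly one vector.
IsPerfectMatching : ∀ {m} → Vec (Fin m) m → Set
IsPerfectMatching f =
  ∀ h → lookup f h ≢ h × lookup f (lookup f h) ≡ h

isPerfectMatching? : ∀ {m} (f : Vec (Fin m) m) → Dec (IsPerfectMatching f)
isPerfectMatching? f =
  all? λ h → ¬? (lookup f h Fin.≟ h) ×-dec (lookup f (lookup f h) Fin.≟ h)

PerfectMatching : ℕ → Set
PerfectMatching m = Σ (Vec (Fin m) m) IsPerfectMatching

partner : ∀ {m} → PerfectMatching m → Fin m → Fin m
partner M = lookup (proj₁ M)

allVecs : ∀ m k → List (Vec (Fin m) k)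
allVecs m zero    = [ [] ]
allVecs m (suc k) = cartesianProductWith _∷_ (allFin m) (allVecs m k)

-- Every perfect matching of m points, listed exactly once.
perfectMatchings : ∀ m → List (PerfectMatching m)
perfectMatchings m =
  mapMaybe (λ f → map (f ,_) (dec⇒maybe (isPerfectMatching? f))) (allVecs m m)

-- The n * d half-edges are Fin (n * d), and quotient d sends a half-edge to
-- the vertex carrying it, so that each vertex carries d of them.  Dropping
-- loops and multiplicities gives the underlying simple graph.
configGraph : ∀ n d → PerfectMatching (n ℕ.* d) → SimpleGraph n
configGraph n d M = record
  { Adj    = λ u v → u ≢ v × ∃[ h ] (vertex h ≡ u × vertex (partner M h) ≡ v)
  ; adj?   = λ u v → ¬? (u Fin.≟ v) ×-dec
      any? λ h → (vertex h Fin.≟ u) ×-dec (vertex (partner M h) Fin.≟ v)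
  ; symm   = λ { (u≢v , h , hu , hv) →
      ≢-sym u≢v , partner M h , hv ,
      trans (cong vertex (proj₂ (proj₂ M h))) hu }
  ; irrefl = λ { u≡v (u≢v , _) → u≢v u≡v }
  }
  where
  vertex : Fin (n ℕ.* d) → Fin n
  vertex = quotient d

------------------------------------------------------------------------
-- Probability

-- Pr(A) ≥ p for a uniformly random entry of Ω: some event S contained in A
-- satisfies |S| ≥ p |Ω|.  (When A is decidable, S can be taken to be A; the
-- intermediate S avoids requiring a decision procedure for A.)
ProbAtLeast : ∀ {a} {X : Set} → List X → (X → Set a) → ℚ → Set a
ProbAtLeast Ω A p =
  ∃[ S ] (S ⊆ Ω × All A S × p * ℕtoℚ (length Ω) ≤ ℕtoℚ (length S))

-- The probability that a random G ∈ 𝒢(n,d) satisfies A tends to 1 as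
-- n → ∞ along the n with d n even.
AAS : ∀ {a} (d : ℕ) → (∀ n → SimpleGraph n → Set a) → Set a
AAS d A =
  ∀ (ε : ℚ) → 0ℚ < ε →
  ∃[ N ] (∀ n → N ℕ.≤ n → 2 ∣ d ℕ.* n →
    ProbAtLeast (perfectMatchings (n ℕ.* d))
                (λ M → A n (configGraph n d M)) (1ℚ - ε))
  where open import Data.Nat.Divisibility.Core using (_∣_)

{-# OPTIONS --safe #-}
module Submission where

-- A graph of small tree-width or tree-depth has a set X of between n/3 and
-- 2n/3 vertices whose members outside one bag S have all their neighbours
-- in X: peel the leaves of the decomposition tree, merging each into its
-- neighbour, until some merged part has n/3 vertices.  In a d-regular
-- configuration at most d |S| half-edges then lead out of X.
--
-- In a random matching of p + q points such sparse cuts are exponentially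
-- rare.  Match the points one by one, always taking one from the side with
-- more unmatched points: near balance, each step stays on its side with
-- probability about 1/2.  Hence the expectation of (1/100) ^ (crossing
-- pairs) is, up to a constant, at most (51/100) ^ min(p, q).  With
-- μ = min(|X|, n − |X|) and d ≥ 3 this is at most (51/100) ^ (3 μ), which is
-- at most (51/80) ^ n (64/125) ^ μ because 3 μ ≥ n.  Summing over all X
-- gives 2 ((51/80) (189/125)) ^ n < 2 (0.964) ^ n.

-- The crude sum diverges: 3 μ ≥ n alone gives (51/100) ^ n for each X, and with nearly 2 ^ n sets X
-- the total is only bounded by about (102/100) ^ n. But most sets X have μ near n/2, and for them
-- sparse cuts are much rarer. Lowering n factors only to 51/80 and keeping (64/125) ^ μ retains
-- this dependence on |X|.
--
-- In the matching process the exponent is a budget limited by the smaller side. A crossing pair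
-- spends one unit and pays 1/100 for it. A pair inside the larger side spends nothing, unless the
-- sides are nearly equal; there every outcome spends one unit, and the probability of about 1/2 for
-- staying inside pays for it. This estimate needs some 50 unmatched points on each side, which
-- accounts for the constant.
--
-- A cut of up to k = n/300 pairs costs a factor 100 ^ k in Markov's inequality. Half of the
-- exponential decay absorbs it and the other half tends to 0. As the cut is at most d |S|, this
-- leads to η = 1/(600 d). All estimates are made in ℕ with denominators cleared.

open import Defs

-- Balanced separations from decompositions of small width or height

module Separations where

  open import Data.Nat.Base as ℕ using (ℕ; zero; suc)
  import Data.Nat.Properties as ℕ
  open import Data.Fin.Base as Fin using (Fin; toℕ; inject₁)
  import Data.Fin.Properties as Fin
  open import Data.Fin.Subset using (Subset; Nonempty; _∈_; _∉_; _∪_; _-_; ∣_∣; ⊤; ⊥; ⁅_⁆)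
  open import Data.Fin.Subset.Properties
    using (_∈?_; ∉⊥; ∈⊤; ∣⊤∣≡n; ∣⊥∣≡0; ∣p∣≤n; p⊆q⇒∣p∣≤∣q∣; x∈p∪q⁻; x∈p∪q⁺; x∈⁅x⁆; x∈⁅y⁆⇒x≡y; ∣⁅x⁆∣≡1;
           p─q⊆p; x∈p∧x≢y⇒x∈p-y; x∈p⇒∣p-x∣<∣p∣)
  open import Data.Bool.Base using (true; false)
  open import Data.Vec.Base using ([]; _∷_; there)
  open import Data.Maybe.Base using (Maybe; just; nothing)
  import Data.Maybe.Properties as Maybe
  open import Data.Product.Base using (∃-syntax; _×_; _,_; proj₁; proj₂)
  open import Data.Sum.Base as Sum using (_⊎_; inj₁; inj₂)
  open import Data.Empty using (⊥-elim)
  open import Level using (0ℓ)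
  open import Relation.Binary.Core using (Rel)
  open import Relation.Binary.Definitions using (Decidable; Symmetric; tri<; tri≈; tri>)
  open import Relation.Binary.Construct.Closure.ReflexiveTransitive using (Star; ε; _◅_; _◅◅_; reverse)
  open import Relation.Binary.PropositionalEquality
    using (_≡_; _≢_; refl; sym; trans; cong; subst; subst₂)
  open import Relation.Nullary.Decidable using (Dec; yes; no; _×-dec_; _⊎-dec_; _→-dec_; ¬?; decidable-stable)
  open import Relation.Nullary.Negation using (¬_)

  ∣p∪q∣≤∣p∣+∣q∣ : ∀ {n} (p q : Subset n) → ∣ p ∪ q ∣ ℕ.≤ ∣ p ∣ ℕ.+ ∣ q ∣
  ∣p∪q∣≤∣p∣+∣q∣ []          []          = ℕ.z≤n
  ∣p∪q∣≤∣p∣+∣q∣ (true ∷ p)  (true ∷ q)  =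
    ℕ.s≤s (ℕ.≤-trans (∣p∪q∣≤∣p∣+∣q∣ p q) (ℕ.+-monoʳ-≤ ∣ p ∣ (ℕ.n≤1+n ∣ q ∣)))
  ∣p∪q∣≤∣p∣+∣q∣ (true ∷ p)  (false ∷ q) = ℕ.s≤s (∣p∪q∣≤∣p∣+∣q∣ p q)
  ∣p∪q∣≤∣p∣+∣q∣ (false ∷ p) (true ∷ q)  =
    ℕ.≤-trans (ℕ.s≤s (∣p∪q∣≤∣p∣+∣q∣ p q)) (ℕ.≤-reflexive (sym (ℕ.+-suc ∣ p ∣ ∣ q ∣)))
  ∣p∪q∣≤∣p∣+∣q∣ (false ∷ p) (false ∷ q) = ∣p∪q∣≤∣p∣+∣q∣ p q

  x∉p-x : ∀ {n} {x : Fin n} (p : Subset n) → x ∉ p - x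
  x∉p-x {x = Fin.zero}  (true ∷ p)  ()
  x∉p-x {x = Fin.zero}  (false ∷ p) ()
  x∉p-x {x = Fin.suc x} (true ∷ p)  (there h) = x∉p-x p h
  x∉p-x {x = Fin.suc x} (false ∷ p) (there h) = x∉p-x p h

  x∈p-y⁻ : ∀ {n} {x y : Fin n} (p : Subset n) → x ∈ p - y → x ∈ p × x ≢ y
  x∈p-y⁻ p x∈ = p─q⊆p p _ x∈ , λ { refl → x∉p-x p x∈ }

  -- At most one neighbour in A, so that an isolated node counts as a leaf too.
  IsLeafOf : ∀ {m} → Rel (Fin m) 0ℓ → Subset m → Fin m → Set
  IsLeafOf E A ℓ = ∀ a b → a ∈ A → b ∈ A → E ℓ a → E ℓ b → a ≡ b

  -- Acyclicity in the form that the merging consumes. Trees and the parent relation of a rooted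
  -- forest both have it, so tree-width and tree-depth share one argument.
  Peelable : ∀ {m} → Rel (Fin m) 0ℓ → Set
  Peelable E = ∀ A → Nonempty A → ∃[ ℓ ] (ℓ ∈ A × IsLeafOf E A ℓ)

  module _ {n m} (Adj : Rel (Fin n) 0ℓ) (E : Rel (Fin m) 0ℓ)
           (E? : Decidable E) (E-sym : Symmetric E) (peelable : Peelable E)
           (S : Fin m → Subset n) where

    Walk : Subset m → Fin n → Rel (Fin m) 0ℓ
    Walk A v = Star (λ a b → (a ∈ A × v ∈ S a) × (b ∈ A × v ∈ S b) × E a b)

    -- The nodes outside A have been merged into nodes of A; W t collects the
    -- bags of everything merged into t.
    record Merged (A : Subset m) (W : Fin m → Subset n) : Set where
      field
        coversV  : ∀ v → ∃[ t ] (t ∈ A × v ∈ W t)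
        coversE  : ∀ u v → Adj u v → ∃[ t ] (t ∈ A × u ∈ W t × v ∈ W t)
        common   : ∀ s t v → s ∈ A → t ∈ A → s ≢ t → v ∈ W s → v ∈ W t → v ∈ S s
        coherent : ∀ v s t → s ∈ A × v ∈ S s → t ∈ A × v ∈ S t → Walk A v s t
        small    : ∀ t → t ∈ A → 3 ℕ.* ∣ W t ∣ ℕ.< n

    Separated : Set
    Separated = ∃[ X ] ∃[ t ] (n ℕ.≤ 3 ℕ.* ∣ X ∣ × 3 ℕ.* ∣ X ∣ ℕ.≤ 2 ℕ.* n ×
      (∀ v u → v ∈ X → v ∉ S t → Adj v u → u ∈ X))

    module _ {A W} (M : Merged A W) {ℓ} (ℓ∈A : ℓ ∈ A) (leaf : IsLeafOf E A ℓ) where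
      open Merged M

      -- A walk enters and leaves a leaf through the same neighbour, so each detour through ℓ
      -- returns to the node it came from and can be cut out.
      avoid : ∀ {v s t} → s ≢ ℓ → t ≢ ℓ → Walk A v s t → Walk (A - ℓ) v s t
      avoid s≢ℓ t≢ℓ ε = ε
      avoid s≢ℓ t≢ℓ (_◅_ {j = a} (s∈ , a∈ , e) w) with a Fin.≟ ℓ
      ... | no a≢ℓ =
        ( (x∈p∧x≢y⇒x∈p-y (proj₁ s∈) s≢ℓ , proj₂ s∈)
        , (x∈p∧x≢y⇒x∈p-y (proj₁ a∈) a≢ℓ , proj₂ a∈) , e) ◅ avoid a≢ℓ t≢ℓ w
      avoid s≢ℓ t≢ℓ ((s∈ , a∈ , e) ◅ ε) | yes refl = ⊥-elim (t≢ℓ refl)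
      avoid s≢ℓ t≢ℓ ((s∈ , a∈ , e) ◅ ((_ , b∈ , e′) ◅ w)) | yes refl
        with refl ← leaf _ _ (proj₁ s∈) (proj₁ b∈) (E-sym e) e′ = avoid s≢ℓ t≢ℓ w

      module _ {p} (p∈A : p ∈ A) (p≢ℓ : p ≢ ℓ)
               (only : ∀ a → a ∈ A → E ℓ a → a ≡ p) where

        X : Subset n
        X = W p ∪ W ℓ

        W′ : Fin m → Subset n
        W′ t with t Fin.≟ p
        ... | yes _ = X
        ... | no  _ = W t

        W′-p : W′ p ≡ X
        W′-p with p Fin.≟ p
        ... | yes _ = refl
        ... | no p≢p = ⊥-elim (p≢p refl)

        W⊆W′ : ∀ {v} t → v ∈ W t → v ∈ W′ t
        W⊆W′ t v∈ with t Fin.≟ p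
        ... | yes refl = x∈p∪q⁺ (inj₁ v∈)
        ... | no  _    = v∈

        -- If the shared vertex comes from W p, the invariant `common` applies directly. If it comes
        -- from W ℓ, it lies in S ℓ and S t, and the walk from ℓ to t given by coherence must begin
        -- with a step to p, the only neighbour of ℓ.
        common-p : ∀ t v → t ∈ A → t ≢ p → t ≢ ℓ → v ∈ X → v ∈ W t → v ∈ S p × v ∈ S t
        common-p t v t∈A t≢p t≢ℓ v∈X v∈t with x∈p∪q⁻ (W p) (W ℓ) v∈X
        ... | inj₁ v∈p = common p t v p∈A t∈A (λ e → t≢p (sym e)) v∈p v∈t
                       , common t p v t∈A p∈A t≢p v∈t v∈p
        ... | inj₂ v∈ℓ = first (coherent v ℓ t (ℓ∈A , Sℓ) (t∈A , St)) , St
          where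
          Sℓ = common ℓ t v ℓ∈A t∈A (λ e → t≢ℓ (sym e)) v∈ℓ v∈t
          St = common t ℓ v t∈A ℓ∈A t≢ℓ v∈t v∈ℓ
          first : Walk A v ℓ t → v ∈ S p
          first ε = ⊥-elim (t≢ℓ refl)
          first ((_ , (a∈A , v∈a) , e) ◅ _) = subst (λ a → v ∈ S a) (only _ a∈A e) v∈a

        -- An edge leaving X is covered by a part other than those of p and ℓ, so its end in X is
        -- shared with that part and lies in S p.
        separates : ∀ v u → v ∈ X → v ∉ S p → Adj v u → u ∈ X
        separates v u v∈X v∉S a with coversE v u a
        ... | t , t∈A , v∈t , u∈t with t Fin.≟ p | t Fin.≟ ℓ
        ... | yes refl | _        = x∈p∪q⁺ (inj₁ u∈t)
        ... | no _     | yes refl = x∈p∪q⁺ (inj₂ u∈t)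
        ... | no t≢p   | no t≢ℓ   =
          ⊥-elim (v∉S (proj₁ (common-p t v t∈A t≢p t≢ℓ v∈X v∈t)))

        merge : 3 ℕ.* ∣ X ∣ ℕ.< n → Merged (A - ℓ) W′
        merge small-X = record
          { coversV  = λ v → let t , t∈ , v∈ = coversV v in relocate₁ t t∈ v∈
          ; coversE  = λ u v a → let t , t∈ , u∈ , v∈ = coversE u v a in relocate t t∈ u∈ v∈
          ; common  = common′
          ; coherent = λ v s t (s∈ , v∈s) (t∈ , v∈t) →
              let s∈A , s≢ℓ = x∈p-y⁻ A s∈
                  t∈A , t≢ℓ = x∈p-y⁻ A t∈
              in avoid s≢ℓ t≢ℓ (coherent v s t (s∈A , v∈s) (t∈A , v∈t))
          ; small    = small′
          }
          where
          p∈A′ : p ∈ A - ℓ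
          p∈A′ = x∈p∧x≢y⇒x∈p-y p∈A p≢ℓ

          relocate : ∀ {u v} t → t ∈ A → u ∈ W t → v ∈ W t →
                     ∃[ t′ ] (t′ ∈ A - ℓ × u ∈ W′ t′ × v ∈ W′ t′)
          relocate {u} {v} t t∈ u∈ v∈ with t Fin.≟ ℓ
          ... | no t≢ℓ   = t , x∈p∧x≢y⇒x∈p-y t∈ t≢ℓ , W⊆W′ t u∈ , W⊆W′ t v∈
          ... | yes refl = p , p∈A′ , subst (u ∈_) (sym W′-p) (x∈p∪q⁺ (inj₂ u∈))
                                    , subst (v ∈_) (sym W′-p) (x∈p∪q⁺ (inj₂ v∈))

          relocate₁ : ∀ {v} t → t ∈ A → v ∈ W t → ∃[ t′ ] (t′ ∈ A - ℓ × v ∈ W′ t′)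
          relocate₁ t t∈ v∈ = let t′ , t′∈ , v∈′ , _ = relocate t t∈ v∈ v∈ in t′ , t′∈ , v∈′

          common′ : ∀ s t v → s ∈ A - ℓ → t ∈ A - ℓ → s ≢ t →
                     v ∈ W′ s → v ∈ W′ t → v ∈ S s
          common′ s t v s∈ t∈ s≢t v∈s v∈t
            with x∈p-y⁻ A s∈ | x∈p-y⁻ A t∈ | s Fin.≟ p | t Fin.≟ p
          ... | _ | _ | yes refl | yes refl = ⊥-elim (s≢t refl)
          ... | _ | t∈A , t≢ℓ | yes refl | no t≢p =
            proj₁ (common-p t v t∈A t≢p t≢ℓ v∈s v∈t)
          ... | s∈A , s≢ℓ | _ | no s≢p | yes refl =
            proj₂ (common-p s v s∈A s≢p s≢ℓ v∈t v∈s)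
          ... | s∈A , _ | t∈A , _ | no _ | no _ = common s t v s∈A t∈A s≢t v∈s v∈t

          small′ : ∀ t → t ∈ A - ℓ → 3 ℕ.* ∣ W′ t ∣ ℕ.< n
          small′ t t∈ with t Fin.≟ p
          ... | yes _ = small-X
          ... | no  _ = small t (p─q⊆p A _ t∈)

        X-upper : 3 ℕ.* ∣ X ∣ ℕ.≤ 2 ℕ.* n
        X-upper = begin
          3 ℕ.* ∣ X ∣                         ≤⟨ ℕ.*-monoʳ-≤ 3 (∣p∪q∣≤∣p∣+∣q∣ (W p) (W ℓ)) ⟩
          3 ℕ.* (∣ W p ∣ ℕ.+ ∣ W ℓ ∣)         ≡⟨ ℕ.*-distribˡ-+ 3 ∣ W p ∣ ∣ W ℓ ∣ ⟩
          3 ℕ.* ∣ W p ∣ ℕ.+ 3 ℕ.* ∣ W ℓ ∣     ≤⟨ ℕ.+-mono-≤ (ℕ.<⇒≤ (small p p∈A)) (ℕ.<⇒≤ (small ℓ ℓ∈A)) ⟩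
          n ℕ.+ n                             ≡⟨ cong (n ℕ.+_) (sym (ℕ.+-identityʳ n)) ⟩
          2 ℕ.* n                             ∎
          where open ℕ.≤-Reasoning

      -- An isolated leaf may be merged into any other node of A, which is how disconnected forests
      -- are handled. If ℓ is the last node, W ℓ contains every vertex, against `small`. The second
      -- alternative is a loop at ℓ, which `peel` rules out.
      only-neighbour : 0 ℕ.< n → ∃[ p ] (p ∈ A × p ≢ ℓ × (∀ a → a ∈ A → E ℓ a → a ≡ p)) ⊎
                       ∃[ p ] (p ∈ A × p ≡ ℓ × E ℓ ℓ)
      only-neighbour 0<n with Fin.any? (λ a → (a ∈? A) ×-dec E? ℓ a)
      ... | yes (a , a∈A , e) with a Fin.≟ ℓ
      ...   | yes refl = inj₂ (ℓ , ℓ∈A , refl , e)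
      ...   | no a≢ℓ = inj₁ (a , a∈A , a≢ℓ , λ b b∈A e′ → leaf b a b∈A a∈A e′ e)
      only-neighbour 0<n | no isolated with Fin.any? (λ a → (a ∈? A) ×-dec ¬? (a Fin.≟ ℓ))
      ... | yes (p , p∈A , p≢ℓ) = inj₁ (p , p∈A , p≢ℓ , λ a a∈A e → ⊥-elim (isolated (a , a∈A , e)))
      ... | no alone = ⊥-elim (ℕ.<-irrefl refl (ℕ.≤-<-trans full (small ℓ ℓ∈A)))
        where
        all∈ : ∀ {v} → v ∈ W ℓ
        all∈ {v} with coversV v
        ... | t , t∈A , v∈t with t Fin.≟ ℓ
        ... | yes refl = v∈t
        ... | no t≢ℓ = ⊥-elim (alone (t , t∈A , t≢ℓ))
        full : n ℕ.≤ 3 ℕ.* ∣ W ℓ ∣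
        full = ℕ.≤-trans (subst (ℕ._≤ ∣ W ℓ ∣) (∣⊤∣≡n n) (p⊆q⇒∣p∣≤∣q∣ {p = ⊤} (λ _ → all∈)))
                 (ℕ.m≤m+n ∣ W ℓ ∣ _)

    module _ (E-irrefl : ∀ {t} → ¬ E t t) (0<n : 0 ℕ.< n) where

      -- Each merge removes a node, and `k` bounds the number of those left. The process stops at
      -- the first union with at least a third of the vertices; its two constituents were still
      -- below a third, whence the upper bound.
      peel : ∀ k {A W} → ∣ A ∣ ℕ.≤ k → Merged A W → Separated
      peel k {A} {W} ∣A∣≤k M
        with ℓ , ℓ∈A , leaf ← peelable A (let t , t∈A , _ = Merged.coversV M (Fin.fromℕ< 0<n) in t , t∈A)
        with only-neighbour M ℓ∈A leaf 0<n
      ... | inj₂ (_ , _ , _ , e) = ⊥-elim (E-irrefl e)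
      ... | inj₁ (p , p∈A , p≢ℓ , only) with 3 ℕ.* ∣ X M ℓ∈A leaf p∈A p≢ℓ only ∣ ℕ.<? n
      ...   | no X≥ = X M ℓ∈A leaf p∈A p≢ℓ only , p , ℕ.≮⇒≥ X≥
                , X-upper M ℓ∈A leaf p∈A p≢ℓ only , separates M ℓ∈A leaf p∈A p≢ℓ only
      ...   | yes X< with k
      ...     | zero   = ⊥-elim (ℕ.n≮0 (ℕ.<-≤-trans (x∈p⇒∣p-x∣<∣p∣ ℓ∈A) ∣A∣≤k))
      ...     | suc k′ = peel k′ (ℕ.s≤s⁻¹ (ℕ.≤-trans (x∈p⇒∣p-x∣<∣p∣ ℓ∈A) ∣A∣≤k))
                           (merge M ℓ∈A leaf p∈A p≢ℓ only X<)

      balanced-separation :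
        (∀ v → ∃[ t ] v ∈ S t) →
        (∀ u v → Adj u v → ∃[ t ] (u ∈ S t × v ∈ S t)) →
        (∀ v s t → v ∈ S s → v ∈ S t → Star (λ a b → v ∈ S a × v ∈ S b × E a b) s t) →
        (∀ t → 3 ℕ.* ∣ S t ∣ ℕ.< n) → Separated
      balanced-separation covV covE coh small = peel m {⊤} {S} (∣p∣≤n ⊤) record
        { coversV  = λ v → let t , v∈ = covV v in t , ∈⊤ , v∈
        ; coversE  = λ u v a → let t , u∈ , v∈ = covE u v a in t , ∈⊤ , u∈ , v∈
        ; common  = λ s t v _ _ _ v∈ _ → v∈
        ; coherent = λ v s t (_ , v∈s) (_ , v∈t) → lift (coh v s t v∈s v∈t)
        ; small    = λ t _ → small t
        }
        where
        lift : ∀ {v s t} → Star (λ a b → v ∈ S a × v ∈ S b × E a b) s t → Walk ⊤ v s t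
        lift ε = ε
        lift ((v∈a , v∈b , e) ◅ w) = ((∈⊤ , v∈a) , (∈⊤ , v∈b) , e) ◅ lift w

  -- Leaves in graphs without cycles

  module _ {m} (T : SimpleGraph m) where

    -- A non-backtracking walk revisits a node; up to its first return it is
    -- injective, and the part between the two visits is a cycle.
    first-return : (w : ℕ → Fin m) → (∀ k → Adj T (w k) (w (suc k))) →
                   (∀ k → w k ≢ w (2 ℕ.+ k)) → Cycle T
    first-return w step nb = search m 0 (ℕ.+-identityʳ m) no-return₀
      where
      NoReturn : ℕ → Set
      NoReturn j = ∀ a b → a ℕ.< b → b ℕ.≤ j → w a ≢ w b

      no-return₀ : NoReturn 0
      no-return₀ a .0 () ℕ.z≤n

      -- A return after one step would be a loop and after two steps a backtrack; any later return
      -- has the length k + 3 that `Cycle` requires.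
      close : ∀ j i → i ℕ.≤ j → NoReturn j → w i ≡ w (suc j) → Cycle T
      close j i i≤j nr eq with ℕ.m≤n⇒∃[o]m+o≡n i≤j
      ... | 0 , refl = ⊥-elim (irrefl T (trans eq (cong (λ x → w (suc x)) (ℕ.+-identityʳ i))) (step i))
      ... | 1 , refl = ⊥-elim (nb i (trans eq (cong w (cong suc (ℕ.+-comm i 1)))))
      ... | suc (suc k) , refl = record
        { k = k
        ; c = λ x → w (i ℕ.+ toℕ x)
        ; distinct = λ {x} {y} → inj x y
        ; steps = λ x → subst₂ (Adj T) (cong (λ z → w (i ℕ.+ z)) (sym (Fin.toℕ-inject₁ x)))
                    (cong w (sym (ℕ.+-suc i (toℕ x)))) (step (i ℕ.+ toℕ x))
        ; closes = subst₂ (Adj T) (cong (λ z → w (i ℕ.+ z)) (sym (Fin.toℕ-fromℕ (2 ℕ.+ k))))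
                    (trans (sym eq) (cong w (sym (ℕ.+-identityʳ i)))) (step (i ℕ.+ (2 ℕ.+ k)))
        }
        where
        bound : ∀ (x : Fin (3 ℕ.+ k)) → i ℕ.+ toℕ x ℕ.≤ i ℕ.+ (2 ℕ.+ k)
        bound x = ℕ.+-monoʳ-≤ i (ℕ.s≤s⁻¹ (Fin.toℕ<n x))
        inj : ∀ x y → w (i ℕ.+ toℕ x) ≡ w (i ℕ.+ toℕ y) → x ≡ y
        inj x y e with ℕ.<-cmp (toℕ x) (toℕ y)
        ... | tri< x<y _ _ = ⊥-elim (nr _ _ (ℕ.+-monoʳ-< i x<y) (bound y) e)
        ... | tri≈ _ x≡y _ = Fin.toℕ-injective x≡y
        ... | tri> _ _ y<x = ⊥-elim (nr _ _ (ℕ.+-monoʳ-< i y<x) (bound x) (sym e))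

      -- When the fuel `f` is exhausted, j is m and the m + 1 nodes visited so far would be
      -- distinct, against the pigeonhole principle.
      search : ∀ f j → f ℕ.+ j ≡ m → NoReturn j → Cycle T
      search zero j refl nr with a , b , a<b , e ← Fin.pigeonhole (ℕ.n<1+n m) (λ x → w (toℕ x)) =
        ⊥-elim (nr _ _ a<b (ℕ.s≤s⁻¹ (Fin.toℕ<n b)) e)
      search (suc f) j eq nr with Fin.any? {n = suc j} (λ a → w (toℕ a) Fin.≟ w (suc j))
      ... | yes (a , e) = close j (toℕ a) (ℕ.s≤s⁻¹ (Fin.toℕ<n a)) nr e
      ... | no none = search f (suc j) (trans (ℕ.+-suc f j) eq) nr′
        where
        nr′ : NoReturn (suc j)
        nr′ a b a<b b≤ e with ℕ.m≤n⇒m<n∨m≡n b≤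
        ... | inj₁ b<  = nr a b a<b (ℕ.s≤s⁻¹ b<) e
        ... | inj₂ refl = none (Fin.fromℕ< a<b , trans (cong w (Fin.toℕ-fromℕ< a<b)) e)

    -- If A had no leaf, a walk in A could always go on to a node other than the one it came from,
    -- which gives an infinite non-backtracking walk.
    acyclic⇒peelable : ¬ Cycle T → Peelable (Adj T)
    acyclic⇒peelable acyclic A (t₀ , t₀∈A)
      with Fin.any? (λ ℓ → (ℓ ∈? A) ×-dec leaf? ℓ)
      where
      leaf? : ∀ ℓ → Dec (IsLeafOf (Adj T) A ℓ)
      leaf? ℓ = Fin.all? λ a → Fin.all? λ b → (a ∈? A) →-dec (b ∈? A) →-dec
                  adj? T ℓ a →-dec adj? T ℓ b →-dec (a Fin.≟ b)
    ... | yes leaf = leaf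
    ... | no noleaf = ⊥-elim (acyclic (first-return (λ k → node (at k)) joined turning))
      where
      Arc : Set
      Arc = ∃[ a ] ∃[ b ] (b ∈ A × Adj T a b)

      next : ∀ a b → b ∈ A → ∃[ c ] (c ∈ A × Adj T b c × a ≢ c)
      next a b b∈A with Fin.any? (λ c → (c ∈? A) ×-dec adj? T b c ×-dec ¬? (a Fin.≟ c))
      ... | yes c = c
      ... | no none = ⊥-elim (noleaf (b , b∈A , λ x y x∈ y∈ ex ey →
              trans (sym (is-a x x∈ ex)) (is-a y y∈ ey)))
        where
        is-a : ∀ x → x ∈ A → Adj T b x → a ≡ x
        is-a x x∈ ex = decidable-stable (a Fin.≟ x) (λ a≢x → none (x , x∈ , ex , a≢x))

      node : Arc → Fin m
      node = proj₁

      forward : Arc → Arc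
      forward (a , b , b∈A , _) = let c , c∈A , e , _ = next a b b∈A in b , c , c∈A , e

      at : ℕ → Arc
      -- There is no previous node yet, so `t₀` itself serves as the node to avoid.
      at zero    = let c , c∈A , e , _ = next t₀ t₀ t₀∈A in t₀ , c , c∈A , e
      at (suc k) = forward (at k)

      joined : ∀ k → Adj T (node (at k)) (node (at (suc k)))
      joined k = proj₂ (proj₂ (proj₂ (at k)))

      turning : ∀ k → node (at k) ≢ node (at (2 ℕ.+ k))
      turning k with a , b , b∈A , _ ← at k = proj₂ (proj₂ (proj₂ (next a b b∈A)))

  -- Separations from tree decompositions and from rooted forests

  maximum-upper : ∀ {m} (f : Fin m → ℕ) t → f t ℕ.≤ maximum f
  maximum-upper f Fin.zero    = ℕ.m≤m⊔n (f Fin.zero) _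
  maximum-upper f (Fin.suc t) =
    ℕ.≤-trans (maximum-upper (λ x → f (Fin.suc x)) t) (ℕ.m≤n⊔m (f Fin.zero) _)

  Separation : ∀ {n} → SimpleGraph n → ℕ → Set
  Separation {n} G s = ∃[ X ] ∃[ S ] (n ℕ.≤ 3 ℕ.* ∣ X ∣ × 3 ℕ.* ∣ X ∣ ℕ.≤ 2 ℕ.* n ×
    ∣ S ∣ ℕ.≤ s × (∀ v u → v ∈ X → v ∉ S → Adj G v u → u ∈ X))

  module _ {n} (G : SimpleGraph n) (0<n : 0 ℕ.< n) where

    treewidth-separation : (D : TreeDecomposition G) →
      3 ℕ.* suc (width D) ℕ.< n → Separation G (suc (width D))
    treewidth-separation D small =
      let X , t , l , u , sep = balanced-separation (Adj G) (Adj tree) (adj? tree) (symm tree)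
            (acyclic⇒peelable tree (proj₂ isTree)) bag (λ e → irrefl tree refl e) 0<n
            coversV coversE
            (λ v s t v∈s v∈t → coherent v s t v∈s v∈t)
            (λ t → ℕ.≤-<-trans (ℕ.*-monoʳ-≤ 3 (bag≤ t)) small)
      in X , bag t , l , u , bag≤ t , sep
      where
      open TreeDecomposition D hiding (width)
      bag≤ : ∀ t → ∣ bag t ∣ ℕ.≤ suc (width D)
      bag≤ t = ℕ.≤-trans (maximum-upper (λ t → ∣ bag t ∣) t)
                 (ℕ.m≤n+m∸n (maximum (λ t → ∣ bag t ∣)) 1)

    module _ (F : RootedForest n) where
      open RootedForest F hiding (ClosureAdj; height)

      -- Going up at most k − 1 steps from t, including t itself.
      ancestors : ℕ → Fin n → Subset n
      above : ℕ → Maybe (Fin n) → Subset n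
      ancestors zero    t = ⊥
      ancestors (suc k) t = ⁅ t ⁆ ∪ above k (parent t)
      above k nothing  = ⊥
      above k (just u) = ancestors k u

      ∣ancestors∣≤ : ∀ k t → ∣ ancestors k t ∣ ℕ.≤ k
      ∣above∣≤ : ∀ k u → ∣ above k u ∣ ℕ.≤ k
      ∣ancestors∣≤ zero t = ℕ.≤-reflexive (∣⊥∣≡0 n)
      ∣ancestors∣≤ (suc k) t = ℕ.≤-trans (∣p∪q∣≤∣p∣+∣q∣ ⁅ t ⁆ _)
        (ℕ.+-mono-≤ (ℕ.≤-reflexive (∣⁅x⁆∣≡1 t)) (∣above∣≤ k (parent t)))
      ∣above∣≤ k nothing  = ℕ.≤-trans (ℕ.≤-reflexive (∣⊥∣≡0 n)) ℕ.z≤n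
      ∣above∣≤ k (just u) = ∣ancestors∣≤ k u

      ancestors-sound : ∀ k {v t} → v ∈ ancestors k t → Ancestor v t
      above-sound : ∀ k {v t} p → parent t ≡ p → v ∈ above k p → Ancestor v t
      ancestors-sound zero v∈ = ⊥-elim (∉⊥ v∈)
      ancestors-sound (suc k) {v} {t} v∈ with x∈p∪q⁻ ⁅ t ⁆ _ v∈
      ... | inj₁ v∈t with refl ← x∈⁅y⁆⇒x≡y t v∈t = ε
      ... | inj₂ v∈↑ = above-sound k (parent t) refl v∈↑
      above-sound k nothing  _  v∈ = ⊥-elim (∉⊥ v∈)
      above-sound k (just u) eq v∈ = ancestors-sound k v∈ ◅◅ (eq ◅ ε)

      depth≥1 : ∀ t → 1 ℕ.≤ depth t
      depth≥1 t with parent t in eq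
      ... | nothing = ℕ.≤-reflexive (sym (depth-root t eq))
      ... | just u  = ℕ.≤-trans (ℕ.s≤s ℕ.z≤n) (ℕ.≤-reflexive (sym (depth-step t u eq)))

      Up : Rel (Fin n) 0ℓ
      Up = Star (λ t u → parent t ≡ just u)

      ancestors-complete : ∀ k {v t} → depth t ℕ.≤ k → Up t v → v ∈ ancestors k t
      ancestors-complete zero {t = t} d≤ _ = ⊥-elim (ℕ.<⇒≱ (depth≥1 t) d≤)
      ancestors-complete (suc k) {t = t} d≤ ε = x∈p∪q⁺ (inj₁ (x∈⁅x⁆ t))
      ancestors-complete (suc k) {v} {t} d≤ (_◅_ {j = u} eq up) =
        x∈p∪q⁺ (inj₂ (subst (λ p → v ∈ above k p) (sym eq) (ancestors-complete k
          (ℕ.s≤s⁻¹ (subst (ℕ._≤ suc k) (depth-step t u eq) d≤)) up)))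

      -- The forest itself, with parent links made symmetric, is the shape of the decomposition; the
      -- bag of a node consists of the node and its ancestors.
      Edge : Rel (Fin n) 0ℓ
      Edge a b = parent a ≡ just b ⊎ parent b ≡ just a

      edge? : Decidable Edge
      edge? a b = Maybe.≡-dec Fin._≟_ (parent a) (just b) ⊎-dec Maybe.≡-dec Fin._≟_ (parent b) (just a)

      edge-irrefl : ∀ {t} → ¬ Edge t t
      edge-irrefl {t} e = ℕ.1+n≢n (sym (depth-step t t (Sum.reduce e)))

      -- `k` bounds the depth still to be gained, and each move to a deeper node of A uses up one
      -- unit.
      deepest : ∀ k A t → t ∈ A → maximum depth ℕ.≤ k ℕ.+ depth t →
                ∃[ ℓ ] (ℓ ∈ A × (∀ a → a ∈ A → depth a ℕ.≤ depth ℓ))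
      deepest zero A t t∈A max≤ = t , t∈A , λ a _ → ℕ.≤-trans (maximum-upper depth a) max≤
      deepest (suc k) A t t∈A max≤ with Fin.any? (λ a → (a ∈? A) ×-dec (depth t ℕ.<? depth a))
      ... | no none = t , t∈A , λ a a∈A → ℕ.≮⇒≥ (λ t<a → none (a , a∈A , t<a))
      ... | yes (a , a∈A , t<a) = deepest k A a a∈A (ℕ.≤-trans max≤
              (ℕ.≤-trans (ℕ.≤-reflexive (sym (ℕ.+-suc k (depth t)))) (ℕ.+-monoʳ-≤ k t<a)))

      -- A deepest node of A has no child in A, so its parent is the only neighbour it can have
      -- there.
      forest-peelable : Peelable Edge
      forest-peelable A (t , t∈A)
        with ℓ , ℓ∈A , max ← deepest (maximum depth) A t t∈A (ℕ.m≤m+n _ _) =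
        ℓ , ℓ∈A , λ a b a∈ b∈ ea eb →
          Maybe.just-injective (trans (sym (up a a∈ ea)) (up b b∈ eb))
        where
        up : ∀ a → a ∈ A → Edge ℓ a → parent ℓ ≡ just a
        up a a∈ (inj₁ e) = e
        up a a∈ (inj₂ e) = ⊥-elim (ℕ.<⇒≱ (ℕ.≤-reflexive (sym (depth-step a ℓ e))) (max a a∈))

      -- An edge of G joins a vertex to an ancestor and so lies in the bag of its lower end. The
      -- nodes whose bags contain v are the descendants of v, and the path from each of them up to v
      -- stays among them; this is coherence.
      treedepth-separation : G ⊆closure F → 3 ℕ.* height F ℕ.< n → Separation G (height F)
      treedepth-separation G⊆F small =
        let X , t , l , u , sep = balanced-separation (Adj G) Edge edge? Sum.swap forest-peelable
              bag edge-irrefl 0<n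
              (λ v → v , complete ε)
              coversE
              (λ v s t v∈s v∈t → climb (up v∈s) ◅◅ reverse flip (climb (up v∈t)))
              (λ t → ℕ.≤-<-trans (ℕ.*-monoʳ-≤ 3 (∣ancestors∣≤ (height F) t)) small)
        in X , bag t , l , u , ∣ancestors∣≤ (height F) t , sep
        where
        bag : Fin n → Subset n
        bag = ancestors (height F)

        complete : ∀ {v t} → Up t v → v ∈ bag t
        complete {t = t} = ancestors-complete (height F) (maximum-upper depth t)

        up : ∀ {v t} → v ∈ bag t → Up t v
        up v∈ = reverse (λ e → e) (ancestors-sound (height F) v∈)

        coversE : ∀ u v → Adj G u v → ∃[ t ] (u ∈ bag t × v ∈ bag t)
        coversE u v a with proj₂ (G⊆F u v a)
        ... | inj₁ u↑v = v , complete (reverse (λ e → e) u↑v) , complete ε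
        ... | inj₂ v↑u = u , complete ε , complete (reverse (λ e → e) v↑u)

        climb : ∀ {v s} → Up s v → Star (λ a b → v ∈ bag a × v ∈ bag b × Edge a b) s v
        climb ε = ε
        climb (e ◅ es) = (complete (e ◅ es) , complete es , inj₁ e) ◅ climb es

        flip : ∀ {v} → Symmetric (λ a b → v ∈ bag a × v ∈ bag b × Edge a b)
        flip (a , b , e) = b , a , Sum.swap e

  -- Trivial upper bounds: a single bag, and a path

  maximum-lub : ∀ {m} (f : Fin m → ℕ) {b} → (∀ t → f t ℕ.≤ b) → maximum f ℕ.≤ b
  maximum-lub {zero}  f f≤ = ℕ.z≤n
  maximum-lub {suc m} f f≤ = ℕ.⊔-lub (f≤ Fin.zero) (maximum-lub (λ t → f (Fin.suc t)) (λ t → f≤ (Fin.suc t)))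

  treewidth≤ : ∀ {n} (G : SimpleGraph n) → tw[ G ]≤ n
  treewidth≤ {n} G = D , ℕ.≤-trans (ℕ.m∸n≤m _ 1) (maximum-lub {1} (λ _ → ∣ ⊤ {n} ∣) (λ _ → ∣p∣≤n ⊤))
    where
    point : SimpleGraph 1
    point = record { Adj = λ a b → a ≢ b ; adj? = λ a b → ¬? (a Fin.≟ b) ; symm = λ a≢b b≡a → a≢b (sym b≡a)
                   ; irrefl = λ a≡b a≢b → a≢b a≡b }
    all≡ : ∀ (s t : Fin 1) → s ≡ t
    all≡ Fin.zero Fin.zero = refl
    D : TreeDecomposition G
    D = record
      { tree     = point
      ; isTree   = (λ { Fin.zero Fin.zero → ε })
                 , (λ C → Cycle.steps C Fin.zero (all≡ _ _))
      ; bag      = λ _ → ⊤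
      ; coversV  = λ _ → Fin.zero , ∈⊤
      ; coversE  = λ _ _ _ → Fin.zero , ∈⊤ , ∈⊤
      ; coherent = λ { v Fin.zero Fin.zero _ _ → ε }
      }

  path : ∀ n → RootedForest n
  path n = record { parent = parent ; depth = λ v → suc (toℕ v) ; depth-root = root ; depth-step = step }
    where
    parent : ∀ {n} → Fin n → Maybe (Fin n)
    parent Fin.zero    = nothing
    parent (Fin.suc v) = just (inject₁ v)
    root : ∀ {n} (v : Fin n) → parent v ≡ nothing → suc (toℕ v) ≡ 1
    root Fin.zero _ = refl
    step : ∀ {n} (v u : Fin n) → parent v ≡ just u → suc (toℕ v) ≡ suc (suc (toℕ u))
    step (Fin.suc v) _ refl = cong (λ k → suc (suc k)) (sym (Fin.toℕ-inject₁ v))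

  path-ancestor : ∀ {n} (u v : Fin n) k → toℕ u ℕ.+ k ≡ toℕ v → RootedForest.Ancestor (path n) u v
  path-ancestor u v zero eq with refl ← Fin.toℕ-injective (trans (sym (ℕ.+-identityʳ (toℕ u))) eq) = ε
  path-ancestor u Fin.zero (suc k) eq with () ← trans (sym (ℕ.+-suc (toℕ u) k)) eq
  path-ancestor u (Fin.suc v) (suc k) eq =
    path-ancestor u (inject₁ v) k (trans (ℕ.suc-injective (trans (sym (ℕ.+-suc (toℕ u) k)) eq)) (sym (Fin.toℕ-inject₁ v)))
    ◅◅ (refl ◅ ε)

  treedepth≤ : ∀ {n} (G : SimpleGraph n) → td[ G ]≤ n
  treedepth≤ {n} G = path n
    , (λ u v a → (λ u≡v → irrefl G u≡v a) , Sum.map (compare u v) (compare v u) (ℕ.≤-total (toℕ u) (toℕ v)))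
    , maximum-lub (λ v → suc (toℕ v)) Fin.toℕ<n
    where
    compare : ∀ u v → toℕ u ℕ.≤ toℕ v → RootedForest.Ancestor (path n) u v
    compare u v u≤v = path-ancestor u v (toℕ v ℕ.∸ toℕ u) (ℕ.m+[n∸m]≡n u≤v)

-- Enumeration of matchings and their weight by crossing pairs

module Matchings where

  open import Data.Nat.Base as ℕ using (ℕ; zero; suc; pred)
  import Data.Nat.Properties as ℕ
  open import Data.Nat.ListAction using (sum; product)
  open import Data.Nat.ListAction.Properties using (sum-++; sum-↭; product-↭)
  open import Data.Bool.Base using (Bool; true; false; if_then_else_)
  open import Data.Fin.Base as Fin using (Fin)
  import Data.Fin.Properties as Fin
  open import Data.Vec.Base as Vec using (Vec; lookup; _[_]≔_)
  import Data.Vec.Properties as Vec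
  open import Data.List.Base as List using (List; []; _∷_; [_]; map; length; concatMap; _++_)
  import Data.List.Properties as List
  open import Data.List.Membership.Propositional using (_∈_; _∉_; find; lose)
  open import Data.List.Membership.Propositional.Properties
    using (∈-map⁺; ∈-map⁻; ∈-concatMap⁺; ∈-concatMap⁻; ∈-∃++)
  open import Data.List.Relation.Unary.Any using (here; there)
  open import Data.List.Relation.Unary.All as All using (All; []; _∷_)
  import Data.List.Relation.Unary.All.Properties as All
  open import Data.List.Relation.Unary.AllPairs as AllPairs using (AllPairs; []; _∷_)
  import Data.List.Relation.Unary.AllPairs.Properties as AllPairs
  open import Data.List.Relation.Unary.Unique.Propositional using (Unique)
  import Data.List.Relation.Unary.Unique.Propositional.Properties as Unique
  open import Data.List.Relation.Binary.Disjoint.Propositional using (Disjoint)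
  open import Data.List.Relation.Binary.Permutation.Propositional
    using (_↭_; ↭-refl; ↭-sym; ↭-trans; prep; swap; ↭⇒↭ₛ)
  open import Data.List.Relation.Binary.Permutation.Propositional.Properties
    using (∈-resp-↭; shift; ↭-length)
    renaming (map⁺ to ↭-map⁺)
  import Data.List.Relation.Binary.Permutation.Setoid.Properties as ↭ₛ
  open import Data.Product.Base using (∃-syntax; _×_; _,_; proj₁; proj₂; map₂)
  open import Data.Empty using (⊥-elim)
  open import Function.Base using (_∘_)
  open import Relation.Binary.PropositionalEquality hiding ([_])
  open import Data.Nat.Tactic.RingSolver using (solve-∀)
  open import Relation.Nullary.Decidable using (yes; no)

  private variable
    A B : Set

  Unique-↭ : {xs ys : List A} → xs ↭ ys → Unique xs → Unique ys
  Unique-↭ {A} σ = ↭ₛ.Unique-resp-↭ (setoid A) (↭⇒↭ₛ σ)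

  sum-map-≤ : {f g : A → ℕ} (xs : List A) → (∀ x → f x ℕ.≤ g x) →
              sum (map f xs) ℕ.≤ sum (map g xs)
  sum-map-≤ []       h = ℕ.z≤n
  sum-map-≤ (x ∷ xs) h = ℕ.+-mono-≤ (h x) (sum-map-≤ xs h)

  -- Each entry of xs is struck from ys once it is used; as xs has no repetitions, the later entries
  -- survive.
  sum-map-mono-⊆ : (f : A → ℕ) {xs ys : List A} → Unique xs → (∀ {x} → x ∈ xs → x ∈ ys) →
                 sum (map f xs) ℕ.≤ sum (map f ys)
  sum-map-mono-⊆ f [] _ = ℕ.z≤n
  sum-map-mono-⊆ f {x ∷ xs} {ys} (x∉xs ∷ u) sub with as , bs , refl ← ∈-∃++ (sub (here refl)) = begin
    f x ℕ.+ sum (map f xs)         ≤⟨ ℕ.+-monoʳ-≤ (f x) (sum-map-mono-⊆ f u sub′) ⟩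
    sum (map f (x ∷ as ++ bs))     ≡⟨ sum-↭ (↭-map⁺ f (↭-sym (shift x as bs))) ⟩
    sum (map f (as ++ x ∷ bs))     ∎
    where
    open ℕ.≤-Reasoning
    sub′ : ∀ {y} → y ∈ xs → y ∈ as ++ bs
    sub′ y∈ with ∈-resp-↭ (shift x as bs) (sub (there y∈))
    ... | here refl = ⊥-elim (All.lookup x∉xs y∈ refl)
    ... | there y∈′ = y∈′

  sum-map-concatMap : (f : B → ℕ) (g : A → List B) (xs : List A) →
    sum (map f (concatMap g xs)) ≡ sum (map (λ x → sum (map f (g x))) xs)
  sum-map-concatMap f g [] = refl
  sum-map-concatMap f g (x ∷ xs) = begin
    sum (map f (g x ++ concatMap g xs))                ≡⟨ cong sum (List.map-++ f (g x) _) ⟩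
    sum (map f (g x) ++ map f (concatMap g xs))        ≡⟨ sum-++ (map f (g x)) _ ⟩
    sum (map f (g x)) ℕ.+ sum (map f (concatMap g xs)) ≡⟨ cong (_ ℕ.+_) (sum-map-concatMap f g xs) ⟩
    sum (map f (g x)) ℕ.+ sum (map (λ x → sum (map f (g x))) xs) ∎
    where open ≡-Reasoning

  sum-map-local : {f g : A → ℕ} (xs : List A) → (∀ {x} → x ∈ xs → f x ≡ g x) →
                  sum (map f xs) ≡ sum (map g xs)
  sum-map-local xs eq = cong sum (List.map-cong-local (All.tabulate eq))

  sum-map-const* : (f : A → ℕ) (c : ℕ) (xs : List A) →
                   sum (map (λ x → c ℕ.* f x) xs) ≡ c ℕ.* sum (map f xs)
  sum-map-const* f c [] = sym (ℕ.*-zeroʳ c)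
  sum-map-const* f c (x ∷ xs) =
    trans (cong (c ℕ.* f x ℕ.+_) (sum-map-const* f c xs)) (sym (ℕ.*-distribˡ-+ c (f x) _))

  length-as-sum : (xs : List A) → length xs ≡ sum (map (λ _ → 1) xs)
  length-as-sum [] = refl
  length-as-sum (x ∷ xs) = cong suc (length-as-sum xs)

  sum-map-const : (c : ℕ) (xs : List A) → sum (map (λ _ → c) xs) ≡ length xs ℕ.* c
  sum-map-const c [] = refl
  sum-map-const c (x ∷ xs) = cong (c ℕ.+_) (sum-map-const c xs)

  picks : List A → List (A × List A)
  picks []       = []
  picks (x ∷ xs) = (x , xs) ∷ map (map₂ (x ∷_)) (picks xs)

  picks-↭ : ∀ {y : A} {ys} xs → (y , ys) ∈ picks xs → xs ↭ y ∷ ys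
  picks-↭ (x ∷ xs) (here refl) = ↭-refl
  picks-↭ (x ∷ xs) (there p) with (y , ys) , p′ , refl ← ∈-map⁻ _ p =
    ↭-trans (prep x (picks-↭ xs p′)) (swap x y ↭-refl)

  map-proj₁-picks : (xs : List A) → map proj₁ (picks xs) ≡ xs
  map-proj₁-picks []       = refl
  map-proj₁-picks (x ∷ xs) =
    cong (x ∷_) (trans (sym (List.map-∘ (picks xs))) (map-proj₁-picks xs))

  ∈-picks : ∀ {y : A} {xs} → y ∈ xs → ∃[ ys ] (y , ys) ∈ picks xs
  ∈-picks {xs = xs} y∈ with (y , ys) , p , refl ← ∈-map⁻ proj₁ (subst (_ ∈_) (sym (map-proj₁-picks xs)) y∈) = ys , p

  sum-picks : (f : A → ℕ) (xs : List A) → sum (map (λ x → f (proj₁ x)) (picks xs)) ≡ sum (map f xs)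
  sum-picks f xs = trans (cong sum (List.map-∘ (picks xs))) (cong (λ z → sum (map f z)) (map-proj₁-picks xs))

  double : ℕ → ℕ
  double zero    = zero
  double (suc N) = suc (suc (double N))

  -- The double factorial (2N - 1)!!, which counts the perfect matchings of 2N points.
  oddFactorial : ℕ → ℕ
  oddFactorial zero    = 1
  oddFactorial (suc N) = suc (double N) ℕ.* oddFactorial N

  module _ {m : ℕ} where

    open import Data.List.Membership.DecPropositional (Fin._≟_ {m}) using (_∈?_)

    Point : Set
    Point = Fin m

    join : Point → Point → Vec Point m → Vec Point m
    join h h′ v = (v [ h′ ]≔ h) [ h ]≔ h′

    lookup-ext : ∀ {v w : Vec Point m} → (∀ x → lookup v x ≡ lookup w x) → v ≡ w
    lookup-ext {v} {w} eq =
      trans (sym (Vec.tabulate∘lookup v)) (trans (Vec.tabulate-cong eq) (Vec.tabulate∘lookup w))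

    join-fst : ∀ h h′ v → lookup (join h h′ v) h ≡ h′
    join-fst h h′ v = Vec.lookup∘updateAt h (v [ h′ ]≔ h)

    join-snd : ∀ {h h′} v → h ≢ h′ → lookup (join h h′ v) h′ ≡ h
    join-snd {h} {h′} v h≢h′ =
      trans (Vec.lookup∘updateAt′ h′ h (h≢h′ ∘ sym) (v [ h′ ]≔ h)) (Vec.lookup∘updateAt h′ v)

    join-other : ∀ {h h′ x} v → x ≢ h → x ≢ h′ → lookup (join h h′ v) x ≡ lookup v x
    join-other {h} {h′} {x} v x≢h x≢h′ =
      trans (Vec.lookup∘updateAt′ x h x≢h (v [ h′ ]≔ h)) (Vec.lookup∘updateAt′ x h′ x≢h′ v)

    unjoin : Point → Point → Vec Point m → Vec Point m
    unjoin h h′ v = (v [ h′ ]≔ h′) [ h ]≔ h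

    unjoin-fst : ∀ h h′ v → lookup (unjoin h h′ v) h ≡ h
    unjoin-fst h h′ v = Vec.lookup∘updateAt h (v [ h′ ]≔ h′)

    unjoin-snd : ∀ h h′ v → lookup (unjoin h h′ v) h′ ≡ h′
    unjoin-snd h h′ v with h′ Fin.≟ h
    ... | yes refl = unjoin-fst h h′ v
    ... | no  h′≢h = trans (Vec.lookup∘updateAt′ h′ h h′≢h (v [ h′ ]≔ h′)) (Vec.lookup∘updateAt h′ v)

    unjoin-other : ∀ {h h′ x} v → x ≢ h → x ≢ h′ → lookup (unjoin h h′ v) x ≡ lookup v x
    unjoin-other {h} {h′} {x} v x≢h x≢h′ =
      trans (Vec.lookup∘updateAt′ x h x≢h (v [ h′ ]≔ h′)) (Vec.lookup∘updateAt′ x h′ x≢h′ v)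

    -- A matching of the points in L is stored as an involution of all m points that fixes the
    -- others, so that partial and complete matchings share one vector type.
    record Matches (L : List Point) (v : Vec Point m) : Set where
      field
        involutive : ∀ x → lookup v (lookup v x) ≡ x
        moved      : ∀ {x} → x ∈ L → lookup v x ≢ x
        fixed      : ∀ {x} → x ∉ L → lookup v x ≡ x

    module _ {h h′ : Point} {L : List Point} (u : Unique (h ∷ h′ ∷ L)) where

      h≢h′ : h ≢ h′
      h≢h′ = All.lookup (AllPairs.head u) (here refl)

      h∉L : h ∉ L
      h∉L h∈ = All.lookup (AllPairs.head u) (there h∈) refl

      h′∉L : h′ ∉ L
      h′∉L h′∈ = All.lookup (AllPairs.head (AllPairs.tail u)) h′∈ refl

      unjoin∘join : ∀ {v} → Matches L v → unjoin h h′ (join h h′ v) ≡ v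
      unjoin∘join {v} M = lookup-ext eq
        where
        eq : ∀ x → lookup (unjoin h h′ (join h h′ v)) x ≡ lookup v x
        eq x with x Fin.≟ h | x Fin.≟ h′
        ... | yes refl | _ = trans (unjoin-fst h h′ (join h h′ v)) (sym (Matches.fixed M h∉L))
        ... | no _ | yes refl = trans (unjoin-snd h h′ (join h h′ v)) (sym (Matches.fixed M h′∉L))
        ... | no x≢h | no x≢h′ = trans (unjoin-other (join h h′ v) x≢h x≢h′) (join-other v x≢h x≢h′)

      join-matches : ∀ {v} → Matches L v → Matches (h ∷ h′ ∷ L) (join h h′ v)
      join-matches {v} M = record { involutive = inv ; moved = mov ; fixed = fix }
        where
        open Matches M
        w = join h h′ v
        inv : ∀ x → lookup w (lookup w x) ≡ x
        inv x with x Fin.≟ h | x Fin.≟ h′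
        ... | yes refl | _ = trans (cong (lookup w) (join-fst h h′ v)) (join-snd v h≢h′)
        ... | no _ | yes refl = trans (cong (lookup w) (join-snd v h≢h′)) (join-fst h h′ v)
        ... | no x≢h | no x≢h′ = trans (cong (lookup w) (join-other v x≢h x≢h′))
                                   (trans (join-other v (avoids x≢h h∉L) (avoids x≢h′ h′∉L)) (involutive x))
          where
          avoids : ∀ {a} → x ≢ a → a ∉ L → lookup v x ≢ a
          avoids x≢a a∉L vx≡a =
            x≢a (trans (sym (involutive x)) (trans (cong (lookup v) vx≡a) (fixed a∉L)))
        mov : ∀ {x} → x ∈ h ∷ h′ ∷ L → lookup w x ≢ x
        mov (here refl) e = h≢h′ (trans (sym e) (join-fst h h′ v))
        mov (there (here refl)) e = h≢h′ (trans (sym (join-snd v h≢h′)) e)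
        mov (there (there x∈)) e = moved x∈ (trans (sym (join-other v
          (λ { refl → h∉L x∈ }) (λ { refl → h′∉L x∈ }))) e)
        fix : ∀ {x} → x ∉ h ∷ h′ ∷ L → lookup w x ≡ x
        fix x∉ = trans (join-other v (x∉ ∘ here) (x∉ ∘ there ∘ here)) (fixed (x∉ ∘ there ∘ there))

      unjoin-matches : ∀ {v} → Matches (h ∷ h′ ∷ L) v → lookup v h ≡ h′ → Matches L (unjoin h h′ v)
      unjoin-matches {v} M vh = record { involutive = inv ; moved = mov ; fixed = fix }
        where
        open Matches M
        w = unjoin h h′ v
        vh′ : lookup v h′ ≡ h
        vh′ = trans (cong (lookup v) (sym vh)) (involutive h)
        inv : ∀ x → lookup w (lookup w x) ≡ x
        inv x with x Fin.≟ h | x Fin.≟ h′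
        ... | yes refl | _ = trans (cong (lookup w) (unjoin-fst h h′ v)) (unjoin-fst h h′ v)
        ... | no _ | yes refl = trans (cong (lookup w) (unjoin-snd h h′ v)) (unjoin-snd h h′ v)
        ... | no x≢h | no x≢h′ = trans (cong (lookup w) (unjoin-other v x≢h x≢h′))
                (trans (unjoin-other v (avoids x≢h′ vh) (avoids x≢h vh′)) (involutive x))
          where
          avoids : ∀ {a b} → x ≢ b → lookup v a ≡ b → lookup v x ≢ a
          avoids x≢b va vx≡a = x≢b (trans (sym (involutive x)) (trans (cong (lookup v) vx≡a) va))
        mov : ∀ {x} → x ∈ L → lookup w x ≢ x
        mov x∈ e = moved (there (there x∈)) (trans (sym (unjoin-other v
          (λ { refl → h∉L x∈ }) (λ { refl → h′∉L x∈ }))) e)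
        fix : ∀ {x} → x ∉ L → lookup w x ≡ x
        fix {x} x∉ with x Fin.≟ h | x Fin.≟ h′
        ... | yes refl | _ = unjoin-fst h h′ v
        ... | no _ | yes refl = unjoin-snd h h′ v
        ... | no x≢h | no x≢h′ = trans (unjoin-other v x≢h x≢h′)
                (fixed (λ { (here e) → x≢h e ; (there (here e)) → x≢h′ e ; (there (there x∈)) → x∉ x∈ }))

      join∘unjoin : ∀ {v} → Matches (h ∷ h′ ∷ L) v → lookup v h ≡ h′ → join h h′ (unjoin h h′ v) ≡ v
      join∘unjoin {v} M vh = lookup-ext eq
        where
        eq : ∀ x → lookup (join h h′ (unjoin h h′ v)) x ≡ lookup v x
        eq x with x Fin.≟ h | x Fin.≟ h′
        ... | yes refl | _ = trans (join-fst h h′ (unjoin h h′ v)) (sym vh)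
        ... | no _ | yes refl = trans (join-snd (unjoin h h′ v) h≢h′)
                (sym (trans (cong (lookup v) (sym vh)) (Matches.involutive M h)))
        ... | no x≢h | no x≢h′ = trans (join-other (unjoin h h′ v) x≢h x≢h′) (unjoin-other v x≢h x≢h′)

    Matches-↭ : ∀ {L L′} → L ↭ L′ → ∀ {v} → Matches L v → Matches L′ v
    Matches-↭ σ M = record
      { involutive = involutive
      ; moved = λ x∈ → moved (∈-resp-↭ (↭-sym σ) x∈)
      ; fixed = λ x∉ → fixed (λ x∈ → x∉ (∈-resp-↭ σ x∈)) }
      where open Matches M

    -- The head of L chooses its partner and the rest is matched recursively, which is the exposure
    -- order that the recursion for the total weight follows.
    matchings : ℕ → List Point → List (Vec Point m)
    matchings zero    L       = [ Vec.allFin m ]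
    matchings (suc N) []      = []
    matchings (suc N) (h ∷ L) = concatMap (λ (h′ , L′) → map (join h h′) (matchings N L′)) (picks L)

    module _ {h : Point} {L : List Point} {h′ L′} (p : (h′ , L′) ∈ picks L) where

      pick-↭ : h ∷ L ↭ h ∷ h′ ∷ L′
      pick-↭ = prep h (picks-↭ L p)

      pick-unique : Unique (h ∷ L) → Unique (h ∷ h′ ∷ L′)
      pick-unique = Unique-↭ pick-↭


    pick-length : ∀ {h′ : Point} {L L′ k} → (h′ , L′) ∈ picks L → length L ≡ suc k → length L′ ≡ k
    pick-length {L = L} p eq = ℕ.suc-injective (trans (sym (↭-length (picks-↭ L p))) eq)

    matchings-sound : ∀ N L {v} → length L ≡ double N → Unique L → v ∈ matchings N L → Matches L v
    matchings-sound zero [] _ _ (here refl) = record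
      { involutive = λ x → trans (Vec.lookup-allFin _) (Vec.lookup-allFin x)
      ; moved = λ () ; fixed = λ {x} _ → Vec.lookup-allFin x }
    matchings-sound (suc N) (h ∷ L) len u v∈
      with (h′ , L′) , p , q ← find (∈-concatMap⁻ _ {xs = picks L} v∈)
      with w , w∈ , refl ← ∈-map⁻ (join h h′) q =
      Matches-↭ (↭-sym (pick-↭ p)) (join-matches uₚ (matchings-sound N L′
        (pick-length p (ℕ.suc-injective len)) (AllPairs.tail (AllPairs.tail uₚ)) w∈))
      where uₚ = pick-unique p u

    matchings-complete : ∀ N L {v} → length L ≡ double N → Unique L → Matches L v → v ∈ matchings N L
    matchings-complete zero [] _ _ M =
      here (lookup-ext (λ x → trans (Matches.fixed M (λ ())) (sym (Vec.lookup-allFin x))))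
    matchings-complete (suc N) (h ∷ L) {v} len u M =
      ∈-concatMap⁺ _ {xs = picks L} (lose p (subst (_∈ map (join h h′) (matchings N L′)) (join∘unjoin uₚ Mₚ refl)
        (∈-map⁺ (join h h′) (matchings-complete N L′ (pick-length p (ℕ.suc-injective len))
          (AllPairs.tail (AllPairs.tail uₚ)) (unjoin-matches uₚ Mₚ refl)))))
      where
      open Matches M
      h′ = lookup v h
      h′∈ : h′ ∈ L
      h′∈ with h′ ∈? h ∷ L
      ... | yes (here e)   = ⊥-elim (moved (here refl) e)
      ... | yes (there ∈L) = ∈L
      ... | no h′∉ = ⊥-elim (moved (here refl) (trans (sym (fixed h′∉)) (involutive h)))
      L′ = proj₁ (∈-picks h′∈)
      p = proj₂ (∈-picks h′∈)
      uₚ = pick-unique p u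
      Mₚ = Matches-↭ (pick-↭ p) M

    matchings-unique : ∀ N L → length L ≡ double N → Unique L → Unique (matchings N L)
    matchings-unique zero L _ _ = [] ∷ []
    matchings-unique (suc N) (h ∷ L) len u = Unique.concat⁺
      (All.map⁺ (All.tabulate each))
      (AllPairs.map⁺ (AllPairs.map disjoint (AllPairs.map⁻ (subst Unique (sym (map-proj₁-picks L)) (AllPairs.tail u)))))
      where
      branch : Point × List Point → List (Vec Point m)
      branch (h′ , L′) = map (join h h′) (matchings N L′)

      each : ∀ {x} → x ∈ picks L → Unique (branch x)
      -- `join h h′` overwrites two entries and is injective only on vectors that agree there, so
      -- uniqueness is pulled back along its left inverse `unjoin h h′`.
      each {h′ , L′} p = Unique.map⁻ (subst Unique (sym undo) (matchings-unique N L′ len′ u′))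
        where
        uₚ = pick-unique p u
        u′ = AllPairs.tail (AllPairs.tail uₚ)
        len′ = pick-length p (ℕ.suc-injective len)
        undo : map (unjoin h h′) (map (join h h′) (matchings N L′)) ≡ matchings N L′
        undo = trans (sym (List.map-∘ (matchings N L′)))
          (List.map-id-local (All.tabulate (λ v∈ → unjoin∘join uₚ (matchings-sound N L′ len′ u′ v∈))))

      disjoint : ∀ {x y} → proj₁ x ≢ proj₁ y → Disjoint (branch x) (branch y)
      disjoint {a , _} {b , _} a≢b (v∈a , v∈b)
        with v , _ , refl ← ∈-map⁻ (join h a) v∈a
        with w , _ , eq ← ∈-map⁻ (join h b) v∈b =
        a≢b (trans (sym (join-fst h a v)) (trans (cong (λ z → lookup z h) eq) (join-fst h b w)))

    length-matchings : ∀ N L → length L ≡ double N → length (matchings N L) ≡ oddFactorial N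
    length-matchings zero L _ = refl
    length-matchings (suc N) (h ∷ L) len = begin
      length (matchings (suc N) (h ∷ L))
        ≡⟨ length-as-sum (matchings (suc N) (h ∷ L)) ⟩
      sum (map (λ _ → 1) (concatMap branch (picks L)))
        ≡⟨ sum-map-concatMap (λ _ → 1) branch (picks L) ⟩
      sum (map (λ x → sum (map (λ _ → 1) (branch x))) (picks L))
        ≡⟨ sum-map-local (picks L) each ⟩
      sum (map (λ _ → oddFactorial N) (picks L))
        ≡⟨ sum-picks (λ _ → oddFactorial N) L ⟩
      sum (map (λ _ → oddFactorial N) L)
        ≡⟨ sum-map-const (oddFactorial N) L ⟩
      length L ℕ.* oddFactorial N
        ≡⟨ cong (ℕ._* oddFactorial N) (ℕ.suc-injective len) ⟩
      oddFactorial (suc N) ∎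
      where
      open ≡-Reasoning
      branch : Point × List Point → List (Vec Point m)
      branch (h′ , L′) = map (join h h′) (matchings N L′)
      each : ∀ {x} → x ∈ picks L → sum (map (λ _ → 1) (branch x)) ≡ oddFactorial N
      each {h′ , L′} p = trans (sym (length-as-sum (branch (h′ , L′))))
        (trans (List.length-map (join h h′) (matchings N L′))
          (length-matchings N L′ (pick-length p (ℕ.suc-injective len))))

  -- cutSum p q is the total weight of the matchings of p + q points, p on the
  -- left and q on the right, where a pair weighs a if it stays on one side
  -- and b if it crosses.
  module CutSum (a b : ℕ) where
    open import Data.Nat.Base using (_+_; _*_)

    cutSum : ℕ → ℕ → ℕ
    cutSum 0 0 = 1
    cutSum 0 1 = 0
    cutSum 0 (suc (suc q)) = suc q * (a * cutSum 0 q)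
    cutSum 1 0 = 0
    cutSum 1 (suc q) = suc q * (b * cutSum 0 q)
    cutSum (suc (suc p)) 0 = suc p * (a * cutSum p 0)
    cutSum (suc (suc p)) (suc q) = suc p * (a * cutSum p (suc q)) + suc q * (b * cutSum (suc p) q)

    -- One formula for all cases: wherever `pred` truncates, the factor in front is zero.
    cutSum-left : ∀ p q → cutSum (suc p) q ≡ p * (a * cutSum (pred p) q) + q * (b * cutSum p (pred q))
    cutSum-left zero    zero    = refl
    cutSum-left zero    (suc q) = refl
    cutSum-left (suc p) zero    = sym (ℕ.+-identityʳ _)
    cutSum-left (suc p) (suc q) = refl

    private
      ring₀ : ∀ a b p y w →
        suc p * (a * (p * (b * y))) + 1 * (b * w) ≡ b * w + suc p * (b * (p * (a * y) + 0))
      ring₀ = solve-∀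

      ring₁ : ∀ a b q f → (2 + q) * (b * (q * (a * f))) ≡
        suc q * (a * (q * (b * f))) + 1 * (b * (q * (a * f)))
      ring₁ = solve-∀

      ring₂ : ∀ a b p q x y z w →
        suc p * (a * (suc q * (a * x) + p * (b * y))) + (b * w + suc q * (b * (q * (a * z) + suc p * (b * x)))) ≡
        suc q * (a * (suc p * (a * x) + q * (b * z))) + (b * w + suc p * (b * (p * (a * y) + suc q * (b * x))))
      ring₂ = solve-∀

    -- `cutSum` exposes a left point whenever there is one, but the larger side may be the right
    -- one. Exposing a left and then a right point yields the same terms as the reverse order; in
    -- the general case `b * w` is the term in which the two exposed points are partners.
    cutSum-right : ∀ p q → cutSum p (suc q) ≡ q * (a * cutSum p (pred q)) + p * (b * cutSum (pred p) q)
    cutSum-right 0 0 = refl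
    cutSum-right 0 (suc q) = sym (ℕ.+-identityʳ _)
    cutSum-right 1 0 = refl
    cutSum-right 1 (suc q) = trans (cong (λ z → (2 + q) * (b * z)) F₀)
      (trans (ring₁ a b q (cutSum 0 (pred q)))
        (cong₂ (λ y z → suc q * (a * y) + 1 * (b * z)) (sym (cutSum-left 0 q)) (sym F₀)))
      where
      F₀ : cutSum 0 (suc q) ≡ q * (a * cutSum 0 (pred q))
      F₀ = trans (cutSum-right 0 q) (ℕ.+-identityʳ _)
    cutSum-right (suc (suc p)) 0 = begin
      suc p * (a * cutSum p 1) + 1 * (b * w)
        ≡⟨ cong (λ z → suc p * (a * z) + 1 * (b * w)) (cutSum-right p 0) ⟩
      suc p * (a * (p * (b * cutSum (pred p) 0))) + 1 * (b * w)
        ≡⟨ ring₀ a b p (cutSum (pred p) 0) w ⟩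
      b * w + suc p * (b * (p * (a * cutSum (pred p) 0) + 0))
        ≡⟨ cong (λ z → b * w + suc p * (b * z)) (sym (cutSum-left p 0)) ⟩
      (2 + p) * (b * w) ∎
      where
      open ≡-Reasoning
      w = cutSum (suc p) 0
    cutSum-right (suc (suc p)) (suc q) = begin
      suc p * (a * cutSum p (2 + q)) + (2 + q) * (b * w)
        ≡⟨ cong₂ (λ u v → suc p * (a * u) + (b * w + suc q * (b * v))) (cutSum-right p (suc q)) (cutSum-right (suc p) q) ⟩
      suc p * (a * (suc q * (a * x) + p * (b * y))) + (b * w + suc q * (b * (q * (a * z) + suc p * (b * x))))
        ≡⟨ ring₂ a b p q x y z w ⟩
      suc q * (a * (suc p * (a * x) + q * (b * z))) + (b * w + suc p * (b * (p * (a * y) + suc q * (b * x))))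
        ≡⟨ cong₂ (λ u v → suc q * (a * u) + (b * w + suc p * (b * v))) (sym (cutSum-left (suc p) q)) (sym (cutSum-left p (suc q))) ⟩
      suc q * (a * cutSum (2 + p) q) + (2 + p) * (b * w) ∎
      where
      open ≡-Reasoning
      w = cutSum (suc p) (suc q)
      x = cutSum p q
      y = cutSum (pred p) (suc q)
      z = cutSum (suc p) (pred q)

  -- Each crossing pair is charged at its left end only, so ω is asymmetric.
  module _ (c : ℕ) {m} (side : Fin m → Bool) where
    open import Data.Nat.Base using (_+_; _*_)
    open CutSum (c * c) c

    ω : Bool → Bool → ℕ
    ω true false = 1
    ω _    _     = c

    weight : List (Fin m) → Vec (Fin m) m → ℕ
    weight L v = product (map (λ h → ω (side h) (side (lookup v h))) L)

    isLeft isRight : Bool → ℕ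
    isLeft b = if b then 1 else 0
    isRight b = if b then 0 else 1

    lefts rights : List (Fin m) → ℕ
    lefts L = sum (map (λ h → isLeft (side h)) L)
    rights L = sum (map (λ h → isRight (side h)) L)

    weight-join : ∀ {h h′ L L′ v} (u : Unique (h ∷ L)) (p : (h′ , L′) ∈ picks L) → Matches L′ v →
      weight (h ∷ L) (join h h′ v) ≡ (ω (side h) (side h′) * ω (side h′) (side h)) * weight L′ v
    weight-join {h} {h′} {L} {L′} {v} u p M = begin
      weight (h ∷ L) w
        ≡⟨ product-↭ (↭-map⁺ (λ x → ω (side x) (side (lookup w x))) (pick-↭ p)) ⟩
      ω (side h) (side (lookup w h)) * (ω (side h′) (side (lookup w h′)) * weight L′ w)
        ≡⟨ cong₂ (λ x y → ω (side h) (side x) * (ω (side h′) (side y) * weight L′ w))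
             (join-fst h h′ v) (join-snd v (h≢h′ uₚ)) ⟩
      ω (side h) (side h′) * (ω (side h′) (side h) * weight L′ w)
        ≡⟨ sym (ℕ.*-assoc (ω (side h) (side h′)) _ _) ⟩
      (ω (side h) (side h′) * ω (side h′) (side h)) * weight L′ w
        ≡⟨ cong ((ω (side h) (side h′) * ω (side h′) (side h)) *_) (cong product rest) ⟩
      (ω (side h) (side h′) * ω (side h′) (side h)) * weight L′ v ∎
      where
      open ≡-Reasoning
      w = join h h′ v
      uₚ = pick-unique p u
      rest : map (λ x → ω (side x) (side (lookup w x))) L′ ≡ map (λ x → ω (side x) (side (lookup v x))) L′
      rest = List.map-cong-local (All.tabulate λ {x} x∈ → cong (λ y → ω (side x) (side y))
        (join-other v (λ { refl → h∉L uₚ x∈ }) (λ { refl → h′∉L uₚ x∈ })))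

    sum-by-side : (g : Bool → ℕ) (L : List (Fin m)) →
      sum (map (λ h → g (side h)) L) ≡ lefts L * g true + rights L * g false
    sum-by-side g [] = refl
    sum-by-side g (h ∷ L) with side h
    ... | true  = trans (cong (g true +_) (sum-by-side g L)) (sym (ℕ.+-assoc (g true) _ _))
    ... | false = trans (cong (g false +_) (sum-by-side g L)) (comm (g false) (lefts L * g true) _)
      where
      comm : ∀ x y z → x + (y + z) ≡ y + (x + z)
      comm = solve-∀

    -- The partner of h affects the weight of what remains only through its side, so the sum over
    -- `picks L` collapses to two terms. They form the recursion of `cutSum` from the side of h.
    total-weight : ∀ N L → length L ≡ double N → Unique L →
      sum (map (weight L) (matchings N L)) ≡ cutSum (lefts L) (rights L)
    total-weight zero [] _ _ = refl
    total-weight (suc N) (h ∷ L) len u = begin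
      sum (map (weight (h ∷ L)) (concatMap branch (picks L)))
        ≡⟨ sum-map-concatMap (weight (h ∷ L)) branch (picks L) ⟩
      sum (map (λ x → sum (map (weight (h ∷ L)) (branch x))) (picks L))
        ≡⟨ sum-map-local (picks L) each ⟩
      sum (map (λ x → g (side (proj₁ x))) (picks L))
        ≡⟨ sum-picks (λ x → g (side x)) L ⟩
      sum (map (λ x → g (side x)) L)
        ≡⟨ sum-by-side g L ⟩
      lefts L * g true + rights L * g false
        ≡⟨ recursion (side h) ⟩
      cutSum (isLeft (side h) + lefts L) (isRight (side h) + rights L) ∎
      where
      open ≡-Reasoning
      branch : Fin m × List (Fin m) → List (Vec (Fin m) m)
      branch (h′ , L′) = map (join h h′) (matchings N L′)

      without : Bool → ℕ
      without true  = cutSum (pred (lefts L)) (rights L)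
      without false = cutSum (lefts L) (pred (rights L))

      g : Bool → ℕ
      g b = (ω (side h) b * ω b (side h)) * without b

      remaining : ∀ {h′ L′} → (h′ , L′) ∈ picks L → cutSum (lefts L′) (rights L′) ≡ without (side h′)
      remaining {h′} {L′} p
        with side h′ | sum-↭ (↭-map⁺ (λ h → isLeft (side h)) (picks-↭ L p))
                     | sum-↭ (↭-map⁺ (λ h → isRight (side h)) (picks-↭ L p))
      ... | true  | eqˡ | eqʳ = sym (cong₂ cutSum (cong pred eqˡ) eqʳ)
      ... | false | eqˡ | eqʳ = sym (cong₂ cutSum eqˡ (cong pred eqʳ))

      each : ∀ {x} → x ∈ picks L → sum (map (weight (h ∷ L)) (branch x)) ≡ g (side (proj₁ x))
      each {h′ , L′} p = begin
        sum (map (weight (h ∷ L)) (map (join h h′) (matchings N L′)))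
          ≡⟨ cong sum (sym (List.map-∘ (matchings N L′))) ⟩
        sum (map (λ v → weight (h ∷ L) (join h h′ v)) (matchings N L′))
          ≡⟨ sum-map-local (matchings N L′) (λ v∈ → weight-join u p (matchings-sound N L′ len′ u′ v∈)) ⟩
        sum (map (λ v → π * weight L′ v) (matchings N L′))
          ≡⟨ sum-map-const* (weight L′) π (matchings N L′) ⟩
        π * sum (map (weight L′) (matchings N L′))
          ≡⟨ cong (π *_) (trans (total-weight N L′ len′ u′) (remaining p)) ⟩
        g (side h′) ∎
        where
        π = ω (side h) (side h′) * ω (side h′) (side h)
        len′ = pick-length p (ℕ.suc-injective len)
        u′ = AllPairs.tail (AllPairs.tail (pick-unique p u))

      recursion : ∀ b → lefts L * ((ω b true * ω true b) * without true) + rights L * ((ω b false * ω false b) * without false)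
        ≡ cutSum (isLeft b + lefts L) (isRight b + rights L)
      recursion true = trans (cong (λ z → lefts L * (c * c * without true) + rights L * (z * without false)) (ℕ.*-identityˡ c))
        (sym (cutSum-left (lefts L) (rights L)))
      recursion false = trans (ℕ.+-comm (lefts L * (c * 1 * without true)) _)
        (trans (cong (λ z → rights L * (c * c * without false) + lefts L * (z * without true)) (ℕ.*-identityʳ c))
        (sym (cutSum-right (lefts L) (rights L))))

-- Exponential bound for the weight of crossing pairs

module CutWeight where

  open Matchings
  open import Data.Nat.Base
  open import Data.Nat.Properties
  open import Data.Product.Base using (∃-syntax; _×_; _,_)
  open import Data.Sum.Base using (_⊎_; inj₁; inj₂)
  open import Relation.Binary.PropositionalEquality
  open import Data.Nat.Tactic.RingSolver using (solve-∀)

  -- The larger side has an even surplus 2j because the total is even. The induction step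
  -- distinguishes j = 0, j = 1 and j ≥ 2.
  excess : ∀ q p N → q ≤ p → p + q ≡ double N → ∃[ j ] (N ≡ q + j × p ≡ q + (j + j))
  excess zero p N _ eq = N , refl , trans (sym (+-identityʳ p)) (trans eq (double≡ N))
    where
    double≡ : ∀ N → double N ≡ N + N
    double≡ zero    = refl
    double≡ (suc N) = cong suc (trans (cong suc (double≡ N)) (sym (+-suc N N)))
  excess (suc q) (suc p) (suc N) (s≤s q≤p) eq
    with j , N≡ , p≡ ← excess q p N q≤p (suc-injective (suc-injective (trans (cong suc (sym (+-suc p q))) eq))) =
    j , cong suc N≡ , cong suc p≡

  -- The two inequalities concern a point exposed on the larger side when the surplus is 0 or 2.
  -- Divided by c times the number of possible partners, they say that the probability of staying
  -- plus 1/c times that of crossing is at most s/c.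
  module CutBound (c s o : ℕ) (c≥1 : 1 ≤ c) (s≥1 : 1 ≤ s)
    (balanced : ∀ k → k * c + suc k ≤ s * (k + suc k))
    (nearly-balanced : ∀ q → o ≤ q → suc q * c + q ≤ s * (suc q + q)) where

    open CutSum (c * c) c

    total : ℕ → ℕ
    total N = (c * c) ^ N * oddFactorial N

    -- The reserve `o` is what `nearly-balanced` asks for. The bound on N matters only when p = q: a
    -- pair on one side then lowers the smaller side by two, while e drops by one.
    Admissible : ℕ → ℕ → ℕ → ℕ → Set
    Admissible e N p q = e ≡ 0 ⊎ (e + o ≤ p × e + o ≤ q × suc (e + o) ≤ N)

    -- With x the total weight, dividing by `total N` and c ^ e shows the meaning: c to the power
    -- minus the number of crossing pairs has expectation at most (s/c) ^ e.
    Bounded : ℕ → ℕ → ℕ → ℕ → Set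
    Bounded N p q x = ∀ e → Admissible e N p q → x * c ^ e ≤ s ^ e * total N

    Bounded-sym : ∀ N p q x → Bounded N p q x → Bounded N q p x
    Bounded-sym N p q x B e (inj₁ e≡0) = B e (inj₁ e≡0)
    Bounded-sym N p q x B e (inj₂ (e≤p , e≤q , e≤N)) = B e (inj₂ (e≤q , e≤p , e≤N))

    module _ {N p q x y} (q≤1+p : q ≤ suc p) (size : suc p + q ≡ double (suc N))
             (Bx : 1 ≤ p → Bounded N (pred p) q x) (By : 1 ≤ q → Bounded N p (pred q) y) where

      private
        a = c * c
        K = total N
        total-suc : total (suc N) ≡ (p + q) * (a * K)
        total-suc = trans (ring a (a ^ N) (suc (double N)) (oddFactorial N)) (cong (_* (a * K)) (sym (suc-injective size)))
          where
          ring : ∀ a t n f → a * t * (n * f) ≡ n * (a * (t * f))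
          ring = solve-∀

        at-zero : p * (a * x) + q * (c * y) ≤ (p + q) * (a * K)
        at-zero = begin
          p * (a * x) + q * (c * y) ≤⟨ +-mono-≤ (left p Bx) (right q By) ⟩
          p * (a * K) + q * (a * K) ≡⟨ sym (*-distribʳ-+ (a * K) p q) ⟩
          (p + q) * (a * K) ∎
          where
          open ≤-Reasoning
          plain : ∀ {z} → z * 1 ≤ 1 * K → z ≤ K
          plain {z} = subst₂ _≤_ (*-identityʳ z) (*-identityˡ K)
          left : ∀ p → (1 ≤ p → Bounded N (pred p) q x) → p * (a * x) ≤ p * (a * K)
          left zero _ = z≤n
          left (suc p) B = *-monoʳ-≤ (suc p) (*-monoʳ-≤ a (plain (B (s≤s z≤n) 0 (inj₁ refl))))
          right : ∀ q → (1 ≤ q → Bounded N p (pred q) y) → q * (c * y) ≤ q * (a * K)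
          right zero _ = z≤n
          right (suc q) B = *-monoʳ-≤ (suc q) (*-mono-≤ (m≤m*n c c {{>-nonZero c≥1}}) (plain (B (s≤s z≤n) 0 (inj₁ refl))))

        -- A crossing pair weighs c instead of c * c and thereby supplies one factor c of the power.
        y-part : ∀ e → y * c ^ e ≤ s ^ e * K → q * (c * y) * (c * c ^ e) ≤ q * (a * (s ^ e * K))
        y-part e h = begin
          q * (c * y) * (c * c ^ e)  ≡⟨ ring q c y (c ^ e) ⟩
          q * (a * (y * c ^ e))      ≤⟨ *-monoʳ-≤ q (*-monoʳ-≤ a h) ⟩
          q * (a * (s ^ e * K))      ∎
          where
          open ≤-Reasoning
          ring : ∀ q c y t → q * (c * y) * (c * t) ≡ q * (c * c * (y * t))
          ring = solve-∀

        -- Far from balance, the larger side loses two points and the exponent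
        -- is kept.
        far : ∀ e → x * c ^ suc e ≤ s ^ suc e * K → y * c ^ e ≤ s ^ e * K →
              (p * (a * x) + q * (c * y)) * c ^ suc e ≤ s ^ suc e * total (suc N)
        far e hx hy = begin
          (p * (a * x) + q * (c * y)) * c ^ suc e
            ≡⟨ *-distribʳ-+ (c ^ suc e) (p * (a * x)) (q * (c * y)) ⟩
          p * (a * x) * c ^ suc e + q * (c * y) * c ^ suc e
            ≤⟨ +-mono-≤ (≤-reflexive (ring₁ p a x (c ^ suc e))) (y-part e hy) ⟩
          p * (a * (x * c ^ suc e)) + q * (a * (s ^ e * K))
            ≤⟨ +-mono-≤ (*-monoʳ-≤ p (*-monoʳ-≤ a hx)) (*-monoʳ-≤ q (*-monoʳ-≤ a (*-monoˡ-≤ K (m≤n*m (s ^ e) s {{>-nonZero s≥1}})))) ⟩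
          p * (a * (s ^ suc e * K)) + q * (a * (s ^ suc e * K))
            ≡⟨ ring₂ p q a (s ^ suc e) K ⟩
          s ^ suc e * ((p + q) * (a * K))
            ≡⟨ cong (s ^ suc e *_) (sym total-suc) ⟩
          s ^ suc e * total (suc N) ∎
          where
          open ≤-Reasoning
          ring₁ : ∀ p a x t → p * (a * x) * t ≡ p * (a * (x * t))
          ring₁ = solve-∀
          ring₂ : ∀ p q a t K → p * (a * (t * K)) + q * (a * (t * K)) ≡ t * ((p + q) * (a * K))
          ring₂ = solve-∀

        -- Near balance, the point is matched within its side with probability
        -- about 1/2, which pays for decreasing the exponent.
        near : ∀ e → p * c + q ≤ s * (p + q) → x * c ^ e ≤ s ^ e * K → y * c ^ e ≤ s ^ e * K →
               (p * (a * x) + q * (c * y)) * c ^ suc e ≤ s ^ suc e * total (suc N)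
        near e half hx hy = begin
          (p * (a * x) + q * (c * y)) * c ^ suc e
            ≡⟨ *-distribʳ-+ (c ^ suc e) (p * (a * x)) (q * (c * y)) ⟩
          p * (a * x) * c ^ suc e + q * (c * y) * c ^ suc e
            ≤⟨ +-mono-≤ (≤-reflexive (ring₁ p a x c (c ^ e))) (y-part e hy) ⟩
          p * (a * (c * (x * c ^ e))) + q * (a * (s ^ e * K))
            ≤⟨ +-monoˡ-≤ _ (*-monoʳ-≤ p (*-monoʳ-≤ a (*-monoʳ-≤ c hx))) ⟩
          p * (a * (c * (s ^ e * K))) + q * (a * (s ^ e * K))
            ≡⟨ ring₂ p q a c (s ^ e) K ⟩
          (p * c + q) * (s ^ e * (a * K))
            ≤⟨ *-monoˡ-≤ _ half ⟩
          s * (p + q) * (s ^ e * (a * K))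
            ≡⟨ ring₃ s (p + q) (s ^ e) (a * K) ⟩
          s ^ suc e * ((p + q) * (a * K))
            ≡⟨ cong (s ^ suc e *_) (sym total-suc) ⟩
          s ^ suc e * total (suc N) ∎
          where
          open ≤-Reasoning
          ring₁ : ∀ p a x c t → p * (a * x) * (c * t) ≡ p * (a * (c * (x * t)))
          ring₁ = solve-∀
          ring₂ : ∀ p q a c t K → p * (a * (c * (t * K))) + q * (a * (t * K)) ≡ (p * c + q) * (t * (a * K))
          ring₂ = solve-∀
          ring₃ : ∀ s n t k → s * n * (t * k) ≡ s * t * (n * k)
          ring₃ = solve-∀

      -- The side with `suc p` points is the larger and exposes one. For a surplus of 0 or 2, both
      -- outcomes lower e by one. For a surplus of at least 4, only a crossing does, because a pair
      -- inside the larger side leaves the smaller side as it is.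
      bounded-step : Bounded (suc N) (suc p) q (p * (a * x) + q * (c * y))
      bounded-step zero _ = begin
        (p * (a * x) + q * (c * y)) * 1 ≡⟨ *-identityʳ _ ⟩
        p * (a * x) + q * (c * y)       ≤⟨ at-zero ⟩
        (p + q) * (a * K)               ≡⟨ sym (trans (*-identityˡ _) total-suc) ⟩
        1 * total (suc N)               ∎
        where open ≤-Reasoning
      bounded-step (suc e) (inj₂ (s≤s e≤p , e≤q , s≤s e<N)) with excess q (suc p) (suc N) q≤1+p size
      ... | 0 , N≡ , p≡ = near e
              (subst (λ z → p * c + z ≤ s * (p + z)) (trans p≡ (+-identityʳ q)) (balanced p))
              (Bx 1≤p e (inj₂ (≤-trans e+o≤ (≤-reflexive (cong pred (sym p≡N))) , ≤-trans (n≤1+n _) e≤q , e<N)))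
              (By 1≤q e (inj₂ (e≤p , pred-mono-≤ e≤q , e<N)))
        where
        p≡N : p ≡ N
        p≡N = suc-injective (trans p≡ (sym N≡))
        1≤p = subst (1 ≤_) (sym p≡N) (≤-trans (s≤s z≤n) e<N)
        1≤q = ≤-trans (s≤s z≤n) e≤q
        e+o≤ : e + o ≤ pred N
        e+o≤ = pred-mono-≤ e<N
      ... | 1 , N≡ , p≡ = near e
              (subst (λ z → z * c + q ≤ s * (z + q)) (sym p≡′) (nearly-balanced q (≤-trans (m≤n+m o (suc e)) e≤q)))
              (Bx (subst (1 ≤_) (sym p≡′) (s≤s z≤n)) e (inj₂
                ( subst (λ z → e + o ≤ pred z) (sym p≡′) (≤-trans (n≤1+n _) e≤q) , ≤-trans (n≤1+n _) e≤q , e<N)))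
              (By (≤-trans (s≤s z≤n) e≤q) e (inj₂ (e≤p , pred-mono-≤ e≤q , e<N)))
        where
        p≡′ : p ≡ suc q
        p≡′ = suc-injective (trans p≡ (+-comm q 2))
      ... | suc (suc j) , N≡ , p≡ = far e
              (Bx (subst (1 ≤_) (sym p≡′) (s≤s z≤n)) (suc e) (inj₂
                ( subst (λ z → suc e + o ≤ pred z) (sym p≡′) (≤-trans e≤q (m≤m+n q _)) , e≤q
                , subst (suc (suc e + o) ≤_) (sym N≡′) (s≤s (≤-trans e≤q (m≤m+n q j))))))
              (By (≤-trans (s≤s z≤n) e≤q) e (inj₂ (e≤p , pred-mono-≤ e≤q , e<N)))
        where
        p≡′ : p ≡ suc (q + (2 + j + j))
        p≡′ = suc-injective (trans p≡ (ring q j))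
          where
          ring : ∀ q j → q + (2 + j + (2 + j)) ≡ suc (suc (q + (2 + j + j)))
          ring = solve-∀
        N≡′ : N ≡ suc (q + j)
        N≡′ = suc-injective (trans N≡ (trans (+-suc q (suc j)) (cong suc (+-suc q j))))

    cutSum-bounded : ∀ N p q → p + q ≡ double N → Bounded N p q (cutSum p q)
    cutSum-bounded zero zero zero _ zero _ = ≤-refl
    cutSum-bounded zero zero zero _ (suc e) (inj₂ (() , _))
    cutSum-bounded (suc N) p q eq with ≤-total q p
    cutSum-bounded (suc N) (suc p) q eq | inj₁ q≤p =
      subst (Bounded (suc N) (suc p) q) (sym (cutSum-left p q)) (bounded-step q≤p eq
        (λ { (s≤s _) → cutSum-bounded N (pred p) q (suc-injective (suc-injective eq)) })
        (λ { (s≤s _) → cutSum-bounded N p (pred q) (suc-injective (suc-injective (trans (cong suc (sym (+-suc p (pred q)))) eq))) }))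
    cutSum-bounded (suc N) p (suc q) eq | inj₂ p≤q =
      Bounded-sym (suc N) (suc q) p (cutSum p (suc q)) (subst (Bounded (suc N) (suc q) p) (sym (cutSum-right p q))
      (bounded-step p≤q eq′
        (λ { (s≤s _) → Bounded-sym N p (pred q) (cutSum p (pred q)) (cutSum-bounded N p (pred q)
          (trans (+-comm p (pred q)) (suc-injective (suc-injective eq′)))) })
        (λ { (s≤s {n = p′} _) → Bounded-sym N p′ q (cutSum p′ q) (cutSum-bounded N p′ q
          (suc-injective (suc-injective (trans (cong suc (sym (+-suc p′ q))) eq)))) })))
      where
      eq′ : suc q + p ≡ double (suc N)
      eq′ = trans (+-comm (suc q) p) eq

-- Counting tools, and the half-edges as a list of points

module HalfEdges where

  open Matchings
  open import Data.Nat.Base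
  open import Data.Nat.Properties
  open import Data.Nat.ListAction using (sum)
  open import Data.Nat.ListAction.Properties using (sum-++)
  open import Data.Bool.Base using (Bool; true; false; if_then_else_)
  open import Data.Fin.Base as Fin using (Fin; combine; quotient)
  import Data.Fin.Properties as Fin
  open import Data.Fin.Subset using (Subset; ∁; ∣_∣)
  open import Data.Vec.Base using (Vec; []; _∷_; lookup)
  open import Data.List.Base as List using (List; []; _∷_; [_]; map; length; filter; _++_; allFin;
    cartesianProductWith; mapMaybe)
  import Data.List.Properties as List
  open import Data.List.Membership.Propositional using (_∈_)
  open import Data.List.Membership.Propositional.Properties
  open import Data.List.Relation.Unary.Any using (here; there)
  open import Data.List.Relation.Unary.All using ([]; _∷_)
  open import Data.List.Relation.Unary.AllPairs using ([]; _∷_)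
  open import Data.List.Relation.Unary.Unique.Propositional using (Unique)
  import Data.List.Relation.Unary.Unique.Propositional.Properties as Unique
  open import Data.Product.Base using (∃-syntax; _×_; _,_; proj₁; proj₂)
  open import Data.Empty using (⊥-elim)
  import Data.Maybe.Base as Maybe
  open import Relation.Binary.PropositionalEquality hiding ([_])
  open import Relation.Nullary.Decidable using (Dec; yes; no; dec⇒maybe)
  open import Data.Nat.Tactic.RingSolver using (solve-∀)
  open import Function.Base using (_∘_)

  private variable
    A B C : Set

  map-proj₁-mapMaybe : {P : A → Set} (P? : ∀ x → Dec (P x)) (xs : List A) →
    map proj₁ (mapMaybe (λ x → Maybe.map (x ,_) (dec⇒maybe (P? x))) xs) ≡ filter P? xs
  map-proj₁-mapMaybe P? [] = refl
  map-proj₁-mapMaybe P? (x ∷ xs) with P? x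
  ... | yes _ = cong (x ∷_) (map-proj₁-mapMaybe P? xs)
  ... | no  _ = map-proj₁-mapMaybe P? xs

  length-filter-map : {P : B → Set} (P? : ∀ x → Dec (P x)) (f : A → B) (xs : List A) →
    length (filter (λ x → P? (f x)) xs) ≡ length (filter P? (map f xs))
  length-filter-map P? f [] = refl
  length-filter-map P? f (x ∷ xs) with P? (f x)
  ... | yes _ = cong suc (length-filter-map P? f xs)
  ... | no  _ = length-filter-map P? f xs

  length-filter-mono : {P Q : A → Set} (P? : ∀ x → Dec (P x)) (Q? : ∀ x → Dec (Q x)) → (∀ x → P x → Q x) →
    ∀ xs → length (filter P? xs) ≤ length (filter Q? xs)
  length-filter-mono P? Q? P⇒Q [] = z≤n
  length-filter-mono P? Q? P⇒Q (x ∷ xs) with P? x | Q? x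
  ... | yes _ | yes _ = s≤s (length-filter-mono P? Q? P⇒Q xs)
  ... | yes p | no ¬q = ⊥-elim (¬q (P⇒Q x p))
  ... | no  _ | yes _ = m≤n⇒m≤1+n (length-filter-mono P? Q? P⇒Q xs)
  ... | no  _ | no  _ = length-filter-mono P? Q? P⇒Q xs

  markov : {P : A → Set} (P? : ∀ x → Dec (P x)) (w : A → ℕ) (t : ℕ) (xs : List A) →
    (∀ x → P x → t ≤ w x) → length (filter P? xs) * t ≤ sum (map w xs)
  markov P? w t [] _ = z≤n
  markov P? w t (x ∷ xs) h with P? x
  ... | yes Px = +-mono-≤ (h x Px) (markov P? w t xs h)
  ... | no  _  = ≤-trans (markov P? w t xs h) (m≤n+m _ (w x))

  union-bound : {P : A → Set} (P? : ∀ x → Dec (P x)) {Q : B → A → Set} (Q? : ∀ b x → Dec (Q b x))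
    (bs : List B) (xs : List A) → (∀ x → P x → ∃[ b ] (b ∈ bs × Q b x)) →
    length (filter P? xs) ≤ sum (map (λ b → length (filter (Q? b) xs)) bs)
  union-bound P? Q? bs [] h = z≤n
  union-bound {P = P} P? {Q} Q? bs (x ∷ xs) h = begin
    length (filter P? (x ∷ xs))                                          ≤⟨ head-P ⟩
    sum (map (λ b → ind b) bs) + length (filter P? xs)                    ≤⟨ +-monoʳ-≤ _ (union-bound P? Q? bs xs h) ⟩
    sum (map ind bs) + sum (map (λ b → length (filter (Q? b) xs)) bs)     ≤⟨ split bs ⟩
    sum (map (λ b → length (filter (Q? b) (x ∷ xs))) bs) ∎
    where
    open ≤-Reasoning
    ind : _ → ℕ
    ind b = length (filter (Q? b) [ x ])
    ind≥1 : ∀ b → Q b x → 1 ≤ ind b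
    ind≥1 b q with Q? b x
    ... | yes _ = ≤-refl
    ... | no ¬q = ⊥-elim (¬q q)
    some : ∀ {b} bs → b ∈ bs → Q b x → 1 ≤ sum (map ind bs)
    some (b ∷ bs) (here refl) q = ≤-trans (ind≥1 b q) (m≤m+n _ _)
    some (b ∷ bs) (there b∈) q = ≤-trans (some bs b∈ q) (m≤n+m _ _)
    head-P : length (filter P? (x ∷ xs)) ≤ sum (map ind bs) + length (filter P? xs)
    head-P with P? x
    ... | yes p = let b , b∈ , q = h x p in +-monoˡ-≤ _ (some bs b∈ q)
    ... | no  _ = m≤n+m _ _
    split : ∀ bs → sum (map ind bs) + sum (map (λ b → length (filter (Q? b) xs)) bs) ≤
                   sum (map (λ b → length (filter (Q? b) (x ∷ xs))) bs)
    split [] = z≤n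
    split (b ∷ bs) = begin
      (ind b + s₁) + (l + s₂) ≡⟨ ring (ind b) s₁ l s₂ ⟩
      (ind b + l) + (s₁ + s₂) ≤⟨ +-mono-≤ one (split bs) ⟩
      _ ∎
      where
      s₁ = sum (map ind bs)
      s₂ = sum (map (λ b → length (filter (Q? b) xs)) bs)
      l = length (filter (Q? b) xs)
      ring : ∀ a b c d → (a + b) + (c + d) ≡ (a + c) + (b + d)
      ring = solve-∀
      one : ind b + l ≤ length (filter (Q? b) (x ∷ xs))
      one with Q? b x
      ... | yes _ = ≤-refl
      ... | no  _ = ≤-refl

  sum-cartesianProductWith : (f : C → ℕ) (g : A → ℕ) (_⊗_ : A → B → C) (xs : List A) (ys : List B) →
    (∀ x y → f (x ⊗ y) ≡ g x) →
    sum (map f (cartesianProductWith _⊗_ xs ys)) ≡ sum (map g xs) * length ys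
  sum-cartesianProductWith f g _⊗_ [] ys eq = refl
  sum-cartesianProductWith f g _⊗_ (x ∷ xs) ys eq = begin
    sum (map f (map (x ⊗_) ys ++ rest))                  ≡⟨ cong sum (List.map-++ f (map (x ⊗_) ys) rest) ⟩
    sum (map f (map (x ⊗_) ys) ++ map f rest)            ≡⟨ sum-++ (map f (map (x ⊗_) ys)) (map f rest) ⟩
    sum (map f (map (x ⊗_) ys)) + sum (map f rest)       ≡⟨ cong₂ _+_ first (sum-cartesianProductWith f g _⊗_ xs ys eq) ⟩
    g x * length ys + sum (map g xs) * length ys         ≡⟨ sym (*-distribʳ-+ (length ys) (g x) _) ⟩
    (g x + sum (map g xs)) * length ys                   ∎
    where
    open ≡-Reasoning
    rest = cartesianProductWith _⊗_ xs ys
    first : sum (map f (map (x ⊗_) ys)) ≡ g x * length ys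
    first = trans (cong sum (trans (sym (List.map-∘ ys)) (List.map-cong (eq x) ys)))
              (trans (sum-map-const (g x) ys) (*-comm (length ys) (g x)))

  subsets : ∀ n → List (Subset n)
  subsets zero    = [ [] ]
  subsets (suc n) = map (true ∷_) (subsets n) ++ map (false ∷_) (subsets n)

  ∈-subsets : ∀ {n} (X : Subset n) → X ∈ subsets n
  ∈-subsets [] = here refl
  ∈-subsets (true ∷ X) = ∈-++⁺ˡ (∈-map⁺ (true ∷_) (∈-subsets X))
  ∈-subsets (false ∷ X) = ∈-++⁺ʳ (map (true ∷_) _) (∈-map⁺ (false ∷_) (∈-subsets X))

  -- The binomial theorem, with subsets in place of binomial coefficients.
  sum-subsets : ∀ n y z → sum (map (λ X → y ^ ∣ X ∣ * z ^ ∣ ∁ X ∣) (subsets n)) ≡ (y + z) ^ n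
  sum-subsets zero y z = refl
  sum-subsets (suc n) y z = begin
    sum (map f (map (true ∷_) (subsets n) ++ map (false ∷_) (subsets n)))
      ≡⟨ cong sum (List.map-++ f (map (true ∷_) (subsets n)) _) ⟩
    sum (map f (map (true ∷_) (subsets n)) ++ map f (map (false ∷_) (subsets n)))
      ≡⟨ sum-++ (map f (map (true ∷_) (subsets n))) _ ⟩
    sum (map f (map (true ∷_) (subsets n))) + sum (map f (map (false ∷_) (subsets n)))
      ≡⟨ cong₂ _+_ (part true y (λ X → *-assoc y (y ^ ∣ X ∣) _)) (part false z (λ X → ring (y ^ ∣ X ∣) z (z ^ ∣ ∁ X ∣))) ⟩
    y * (y + z) ^ n + z * (y + z) ^ n
      ≡⟨ sym (*-distribʳ-+ ((y + z) ^ n) y z) ⟩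
    (y + z) ^ suc n ∎
    where
    open ≡-Reasoning
    f : ∀ {n} → Subset n → ℕ
    f X = y ^ ∣ X ∣ * z ^ ∣ ∁ X ∣
    ring : ∀ a z b → a * (z * b) ≡ z * (a * b)
    ring = solve-∀
    part : ∀ b t → (∀ X → f (b ∷ X) ≡ t * f X) → sum (map f (map (b ∷_) (subsets n))) ≡ t * (y + z) ^ n
    part b t eq = begin
      sum (map f (map (b ∷_) (subsets n)))   ≡⟨ cong sum (sym (List.map-∘ (subsets n))) ⟩
      sum (map (λ X → f (b ∷ X)) (subsets n)) ≡⟨ cong sum (List.map-cong eq (subsets n)) ⟩
      sum (map (λ X → t * f X) (subsets n))  ≡⟨ sum-map-const* f t (subsets n) ⟩
      t * sum (map f (subsets n))            ≡⟨ cong (t *_) (sum-subsets n y z) ⟩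
      t * (y + z) ^ n                        ∎

  ∣X∣+∣∁X∣ : ∀ {n} (X : Subset n) → ∣ X ∣ + ∣ ∁ X ∣ ≡ n
  ∣X∣+∣∁X∣ [] = refl
  ∣X∣+∣∁X∣ (true ∷ X) = cong suc (∣X∣+∣∁X∣ X)
  ∣X∣+∣∁X∣ (false ∷ X) = trans (+-suc ∣ X ∣ _) (cong suc (∣X∣+∣∁X∣ X))

  sum-tabulate-left : ∀ {n} (X : Subset n) → sum (List.tabulate (λ v → if lookup X v then 1 else 0)) ≡ ∣ X ∣
  sum-tabulate-left [] = refl
  sum-tabulate-left (true ∷ X) = cong suc (sum-tabulate-left X)
  sum-tabulate-left (false ∷ X) = sum-tabulate-left X

  sum-tabulate-right : ∀ {n} (X : Subset n) → sum (List.tabulate (λ v → if lookup X v then 0 else 1)) ≡ ∣ ∁ X ∣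
  sum-tabulate-right [] = refl
  sum-tabulate-right (true ∷ X) = sum-tabulate-right X
  sum-tabulate-right (false ∷ X) = cong suc (sum-tabulate-right X)

  -- Listed as a product, so that sums of functions of the vertex factor.
  halfEdges : ∀ n d → List (Fin (n * d))
  halfEdges n d = cartesianProductWith combine (allFin n) (allFin d)

  halfEdges-unique : ∀ n d → Unique (halfEdges n d)
  halfEdges-unique n d = Unique.cartesianProductWith⁺ combine (Fin.combine-injective _ _ _ _)
    (Unique.allFin⁺ n) (Unique.allFin⁺ d)

  ∈-halfEdges : ∀ n d h → h ∈ halfEdges n d
  ∈-halfEdges n d h with i , j , refl ← Fin.combine-surjective {n} {d} h =
    ∈-cartesianProductWith⁺ combine (∈-allFin i) (∈-allFin j)

  sum-halfEdges : ∀ n d (g : Fin n → ℕ) →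
    sum (map (λ h → g (quotient d h)) (halfEdges n d)) ≡ sum (List.tabulate g) * d
  sum-halfEdges n d g = trans
    (sum-cartesianProductWith (λ h → g (quotient d h)) g combine (allFin n) (allFin d)
      (λ i j → cong (g ∘ proj₁) (Fin.remQuot-combine {n} i j)))
    (cong₂ _*_ (cong sum (List.map-tabulate (λ x → x) g)) (List.length-tabulate (λ (x : Fin d) → x)))

  length-halfEdges : ∀ n d → length (halfEdges n d) ≡ n * d
  length-halfEdges n d = trans (length-as-sum (halfEdges n d)) (trans (sum-halfEdges n d (λ _ → 1))
    (cong (_* d) (ones n)))
    where
    ones : ∀ n → sum (List.tabulate {n = n} (λ _ → 1)) ≡ n
    ones zero    = refl
    ones (suc n) = cong suc (ones n)

  -- Without the proof components, uniqueness and membership become statements about vectors alone.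
  matchingVecs : ∀ m → List (Vec (Fin m) m)
  matchingVecs m = map proj₁ (perfectMatchings m)

  ∈-allVecs : ∀ {m k} (v : Vec (Fin m) k) → v ∈ allVecs m k
  ∈-allVecs [] = here refl
  ∈-allVecs (x ∷ v) = ∈-cartesianProductWith⁺ _∷_ (∈-allFin x) (∈-allVecs v)

  allVecs-unique : ∀ m k → Unique (allVecs m k)
  allVecs-unique m zero    = [] ∷ []
  allVecs-unique m (suc k) =
    Unique.cartesianProductWith⁺ _∷_ (λ { refl → refl , refl }) (Unique.allFin⁺ m) (allVecs-unique m k)

  matchingVecs≡ : ∀ m → matchingVecs m ≡ filter isPerfectMatching? (allVecs m m)
  matchingVecs≡ m = map-proj₁-mapMaybe isPerfectMatching? (allVecs m m)

  matchingVecs-unique : ∀ m → Unique (matchingVecs m)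
  matchingVecs-unique m = subst Unique (sym (matchingVecs≡ m))
    (Unique.filter⁺ isPerfectMatching? (allVecs-unique m m))

  ∈-matchingVecs⁺ : ∀ {m} {v : Vec (Fin m) m} → IsPerfectMatching v → v ∈ matchingVecs m
  ∈-matchingVecs⁺ {m} {v} pm = subst (v ∈_) (sym (matchingVecs≡ m)) (∈-filter⁺ isPerfectMatching? (∈-allVecs v) pm)

  ∈-matchingVecs⁻ : ∀ {m} {v : Vec (Fin m) m} → v ∈ matchingVecs m → IsPerfectMatching v
  ∈-matchingVecs⁻ {m} {v} v∈ = proj₂ (∈-filter⁻ isPerfectMatching? {xs = allVecs m m} (subst (v ∈_) (matchingVecs≡ m) v∈))

  module _ {m} (H : List (Fin m)) (H! : Unique H) (∈H : ∀ h → h ∈ H) (N : ℕ) (len : length H ≡ double N) where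

    -- The recursive enumeration and the filtered one contain the same vectors, each once. The
    -- estimate takes from this an upper bound on weights and, in `oddFactorial≤length`, a lower
    -- bound on the number of matchings.
    sum-matchingVecs≤ : (w : Vec (Fin m) m → ℕ) → sum (map w (matchingVecs m)) ≤ sum (map w (matchings N H))
    sum-matchingVecs≤ w = sum-map-mono-⊆ w (matchingVecs-unique m) λ v∈ →
      let pm = ∈-matchingVecs⁻ v∈ in matchings-complete N H len H! record
        { involutive = λ x → proj₂ (pm x)
        ; moved      = λ {x} _ → proj₁ (pm x)
        ; fixed      = λ {x} x∉ → ⊥-elim (x∉ (∈H x)) }

    oddFactorial≤length : oddFactorial N ≤ length (matchingVecs m)
    oddFactorial≤length = subst₂ _≤_
      (trans (sym (length-as-sum (matchings N H))) (length-matchings N H len))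
      (sym (length-as-sum (matchingVecs m)))
      (sum-map-mono-⊆ (λ _ → 1) (matchings-unique N H len H!) λ v∈ →
        let M = matchings-sound N H len H! v∈ in
        ∈-matchingVecs⁺ (λ h → Matches.moved M (∈H h) , Matches.involutive M h))

  module _ {m} (side : Fin m → Bool) where

    crosses : Bool → Bool → ℕ
    crosses true false = 1
    crosses _    _     = 0

    cut : List (Fin m) → Vec (Fin m) m → ℕ
    cut L v = sum (map (λ h → crosses (side h) (side (lookup v h))) L)

    -- Each point contributes its factor c either to the weight or to the cut, so a small cut means
    -- a large weight.
    weight-cut : ∀ c L v → weight c side L v * c ^ cut L v ≡ c ^ length L
    weight-cut c [] v = refl
    weight-cut c (h ∷ L) v with side h | side (lookup v h)
    ... | true  | true  = trans (*-assoc c (weight c side L v) _) (cong (c *_) (weight-cut c L v))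
    ... | true  | false = trans (ring (weight c side L v) c (c ^ cut L v)) (cong (c *_) (weight-cut c L v))
      where
      ring : ∀ w c t → 1 * w * (c * t) ≡ c * (w * t)
      ring = solve-∀
    ... | false | _     = trans (*-assoc c (weight c side L v) _) (cong (c *_) (weight-cut c L v))

-- Union bound over balanced vertex sets

module SparseCuts where

  open Matchings
  open CutWeight
  open HalfEdges
  open import Data.Nat.Base
  open import Data.Nat.Properties
  open import Data.Nat.ListAction using (sum)
  open import Data.Bool.Base using (Bool; if_then_else_)
  open import Data.Fin.Base using (Fin; quotient)
  open import Data.Fin.Subset using (Subset; ∁; ∣_∣)
  import Data.Fin.Subset.Properties as Subset
  open import Data.Vec.Base using (Vec; lookup)
  open import Data.List.Base as List using (List; []; _∷_; map; length; filter)
  import Data.List.Properties as List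
  import Data.List.Relation.Unary.All as All
  open import Data.Product.Base using (∃-syntax; _×_; _,_; proj₁; proj₂)
  open import Data.Sum.Base using (inj₁; inj₂)
  open import Relation.Binary.PropositionalEquality
  open import Relation.Nullary.Decidable using (Dec; yes; no; _×-dec_)
  open import Data.Nat.Tactic.RingSolver using (solve-∀)

  ^-double : ∀ c N → c ^ double N ≡ (c * c) ^ N
  ^-double c zero    = refl
  ^-double c (suc N) = trans (cong (λ z → c * (c * z)) (^-double c N)) (sym (*-assoc c c _))

  ^-* : ∀ x y n → (x * y) ^ n ≡ x ^ n * y ^ n
  ^-* x y zero    = refl
  ^-* x y (suc n) = trans (cong (x * y *_) (^-* x y n)) (ring x y (x ^ n) (y ^ n))
    where
    ring : ∀ x y a b → x * y * (a * b) ≡ x * a * (y * b)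
    ring = solve-∀

  double-mono⁻ : ∀ a N → a + a ≤ double N → a ≤ N
  double-mono⁻ zero    N       _ = z≤n
  double-mono⁻ (suc a) (suc N) (s≤s h) =
    s≤s (double-mono⁻ a N (s≤s⁻¹ (subst (_≤ suc (double N)) (+-suc a a) h)))

  Balanced : ∀ {n} → Subset n → Set
  Balanced {n} X = n ≤ 3 * ∣ X ∣ × 3 * ∣ X ∣ ≤ 2 * n

  balanced? : ∀ {n} (X : Subset n) → Dec (Balanced X)
  balanced? {n} X = n ≤? 3 * ∣ X ∣ ×-dec 3 * ∣ X ∣ ≤? 2 * n

  module _ (n d : ℕ) where

    vertexSide : Subset n → Fin (n * d) → Bool
    vertexSide X h = lookup X (quotient d h)

    cutSize : Subset n → Vec (Fin (n * d)) (n * d) → ℕ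
    cutSize X v = cut (vertexSide X) (halfEdges n d) v

    SparseCut : ℕ → Subset n → Vec (Fin (n * d)) (n * d) → Set
    SparseCut k X v = Balanced X × cutSize X v ≤ k

    sparseCut? : ∀ k X v → Dec (SparseCut k X v)
    sparseCut? k X v = balanced? X ×-dec (cutSize X v ≤? k)

    hasSparseCut? : ∀ k v → Dec (∃[ X ] SparseCut k X v)
    hasSparseCut? k v = Subset.anySubset? (λ X → sparseCut? k X v)

  module UnionBound (n d N : ℕ) (3≤d : 3 ≤ d) (even : n * d ≡ double N)
    (c s o u x y : ℕ) (1≤c : 1 ≤ c) (1≤s : 1 ≤ s) (s≤c : s ≤ c) (s≤u : s ≤ u)
    (balanced : ∀ k → k * c + suc k ≤ s * (k + suc k))
    (nearly-balanced : ∀ q → o ≤ q → suc q * c + q ≤ s * (suc q + q))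
    (scale : u ^ 3 * y ≡ c ^ 3 * x) where

    open CutSum (c * c) c
    open CutBound c s o 1≤c 1≤s balanced nearly-balanced

    Ω : List (Vec (Fin (n * d)) (n * d))
    Ω = matchingVecs (n * d)

    private
      H = halfEdges n d
      len : length H ≡ double N
      len = trans (length-halfEdges n d) even
      instance
        c≢0 : NonZero c
        c≢0 = >-nonZero 1≤c
        s≢0 : NonZero s
        s≢0 = >-nonZero 1≤s
        u≢0 : NonZero u
        u≢0 = >-nonZero (≤-trans 1≤s s≤u)

    -- Markov's inequality: a matching with at most k crossing pairs weighs at least c ^ (-k) times
    -- the weight (c * c) ^ N of one without crossings.
    sparse-cuts≤cutSum : ∀ k X → length (filter (λ v → cutSize n d X v ≤? k) Ω) * (c * c) ^ N ≤
      c ^ k * cutSum (∣ X ∣ * d) (∣ ∁ X ∣ * d)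
    sparse-cuts≤cutSum k X = begin
      length (filter (λ v → cutSize n d X v ≤? k) Ω) * (c * c) ^ N
        ≤⟨ markov (λ v → cutSize n d X v ≤? k) (λ v → c ^ k * w v) _ Ω heavy ⟩
      sum (map (λ v → c ^ k * w v) Ω)
        ≡⟨ sum-map-const* w (c ^ k) Ω ⟩
      c ^ k * sum (map w Ω)
        ≤⟨ *-monoʳ-≤ (c ^ k) (sum-matchingVecs≤ H (halfEdges-unique n d) (∈-halfEdges n d) N len w) ⟩
      c ^ k * sum (map w (matchings N H))
        ≡⟨ cong (c ^ k *_) (total-weight c (vertexSide n d X) N H len (halfEdges-unique n d)) ⟩
      c ^ k * cutSum (lefts c (vertexSide n d X) H) (rights c (vertexSide n d X) H)
        ≡⟨ cong₂ (λ p q → c ^ k * cutSum p q)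
             (trans (sum-halfEdges n d (λ v → if lookup X v then 1 else 0)) (cong (_* d) (sum-tabulate-left X)))
             (trans (sum-halfEdges n d (λ v → if lookup X v then 0 else 1)) (cong (_* d) (sum-tabulate-right X))) ⟩
      c ^ k * cutSum (∣ X ∣ * d) (∣ ∁ X ∣ * d) ∎
      where
      open ≤-Reasoning
      w = weight c (vertexSide n d X) H
      heavy : ∀ v → cutSize n d X v ≤ k → (c * c) ^ N ≤ c ^ k * w v
      heavy v cut≤k = begin
        (c * c) ^ N            ≡⟨ sym (trans (cong (c ^_) len) (^-double c N)) ⟩
        c ^ length H           ≡⟨ sym (weight-cut (vertexSide n d X) c H v) ⟩
        w v * c ^ cutSize n d X v ≤⟨ *-monoʳ-≤ (w v) (^-monoʳ-≤ c cut≤k) ⟩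
        w v * c ^ k            ≡⟨ *-comm (w v) _ ⟩
        c ^ k * w v            ∎

    smaller : Subset n → ℕ
    smaller X = ∣ X ∣ ⊓ ∣ ∁ X ∣

    sparse-cuts-bound : ∀ k X → length (filter (λ v → cutSize n d X v ≤? k) Ω) * c ^ (3 * smaller X) ≤
      c ^ (k + suc o) * length Ω * s ^ (3 * smaller X)
    sparse-cuts-bound k X = *-cancelʳ-≤ _ _ ((c * c) ^ N) {{m^n≢0 (c * c) N {{m*n≢0 c c}}}} (begin
      ℓ * c ^ (3 * μ) * (c * c) ^ N
        ≤⟨ *-monoˡ-≤ ((c * c) ^ N) (*-monoʳ-≤ ℓ (^-monoʳ-≤ c (m≤n+m∸n (3 * μ) (suc o)))) ⟩
      ℓ * c ^ (suc o + e) * (c * c) ^ N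
        ≡⟨ cong (λ z → ℓ * z * (c * c) ^ N) (^-distribˡ-+-* c (suc o) e) ⟩
      ℓ * (c ^ suc o * c ^ e) * (c * c) ^ N
        ≡⟨ ring₁ ℓ (c ^ suc o) (c ^ e) ((c * c) ^ N) ⟩
      c ^ suc o * c ^ e * (ℓ * (c * c) ^ N)
        ≤⟨ *-monoʳ-≤ (c ^ suc o * c ^ e) (sparse-cuts≤cutSum k X) ⟩
      c ^ suc o * c ^ e * (c ^ k * F)
        ≡⟨ ring₂ (c ^ suc o) (c ^ e) (c ^ k) F ⟩
      c ^ k * c ^ suc o * (F * c ^ e)
        ≤⟨ *-monoʳ-≤ (c ^ k * c ^ suc o) (cutSum-bounded N _ _ sides e admissible) ⟩
      c ^ k * c ^ suc o * (s ^ e * ((c * c) ^ N * oddFactorial N))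
        ≤⟨ *-monoʳ-≤ (c ^ k * c ^ suc o) (*-mono-≤ (^-monoʳ-≤ s (m∸n≤m (3 * μ) (suc o)))
             (*-monoʳ-≤ ((c * c) ^ N) (oddFactorial≤length H (halfEdges-unique n d) (∈-halfEdges n d) N len))) ⟩
      c ^ k * c ^ suc o * (s ^ (3 * μ) * ((c * c) ^ N * length Ω))
        ≡⟨ cong (_* (s ^ (3 * μ) * ((c * c) ^ N * length Ω))) (sym (^-distribˡ-+-* c k (suc o))) ⟩
      c ^ (k + suc o) * (s ^ (3 * μ) * ((c * c) ^ N * length Ω))
        ≡⟨ ring₃ (c ^ (k + suc o)) (s ^ (3 * μ)) ((c * c) ^ N) (length Ω) ⟩
      c ^ (k + suc o) * length Ω * s ^ (3 * μ) * (c * c) ^ N ∎)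
      where
      open ≤-Reasoning
      μ = smaller X
      -- `Admissible` wants both sides to exceed e by `o`, and N by `suc o`. Shortening the exponent
      -- by `suc o` provides this at the price of the constant c ^ (o + 1).
      e = 3 * μ ∸ suc o
      ℓ = length (filter (λ v → cutSize n d X v ≤? k) Ω)
      F = cutSum (∣ X ∣ * d) (∣ ∁ X ∣ * d)
      ring₁ : ∀ l a b t → l * (a * b) * t ≡ a * b * (l * t)
      ring₁ = solve-∀
      ring₂ : ∀ a b k f → a * b * (k * f) ≡ k * a * (f * b)
      ring₂ = solve-∀
      ring₃ : ∀ a b t l → a * (b * (t * l)) ≡ a * l * b * t
      ring₃ = solve-∀
      sides : ∣ X ∣ * d + ∣ ∁ X ∣ * d ≡ double N
      sides = trans (sym (*-distribʳ-+ d ∣ X ∣ _)) (trans (cong (_* d) (∣X∣+∣∁X∣ X)) even)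
      -- The degree enters here: either side of the cut carries at least three half-edges per
      -- vertex.
      3μ≤μd : 3 * μ ≤ μ * d
      3μ≤μd = subst (_≤ μ * d) (*-comm μ 3) (*-monoʳ-≤ μ 3≤d)
      3μ≤p : 3 * μ ≤ ∣ X ∣ * d
      3μ≤p = ≤-trans 3μ≤μd (*-monoˡ-≤ d (m⊓n≤m ∣ X ∣ _))
      3μ≤q : 3 * μ ≤ ∣ ∁ X ∣ * d
      3μ≤q = ≤-trans 3μ≤μd (*-monoˡ-≤ d (m⊓n≤n ∣ X ∣ _))
      3μ≤N : 3 * μ ≤ N
      3μ≤N = double-mono⁻ (3 * μ) N (≤-trans (+-mono-≤ 3μ≤p 3μ≤q) (≤-reflexive sides))
      admissible : Admissible e N (∣ X ∣ * d) (∣ ∁ X ∣ * d)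
      admissible with ≤-total (3 * μ) (suc o)
      ... | inj₁ 3μ≤ = inj₁ (m≤n⇒m∸n≡0 3μ≤)
      ... | inj₂ o<3μ = inj₂ (≤-trans (<⇒≤ e+o<) 3μ≤p , ≤-trans (<⇒≤ e+o<) 3μ≤q , ≤-trans e+o< 3μ≤N)
        where
        e+o< : suc (e + o) ≤ 3 * μ
        e+o< = ≤-reflexive (trans (sym (+-suc e o)) (m∸n+n≡m o<3μ))

    -- Write (s/c) ^ (3 μ) as (s/u) ^ (3 μ) (u/c) ^ (3 μ). The first factor is at most (s/u) ^ n
    -- because s ≤ u and n ≤ 3 μ; by `scale` the second is (x/y) ^ μ. The surplus i = 3 μ - n is
    -- cancelled as u ^ i.
    trade : ∀ ℓ K μ → n ≤ 3 * μ → ℓ * c ^ (3 * μ) ≤ K * s ^ (3 * μ) →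
            ℓ * (u ^ n * y ^ μ) ≤ K * (s ^ n * x ^ μ)
    trade ℓ K μ n≤3μ h with i , eq ← m≤n⇒∃[o]m+o≡n n≤3μ =
      *-cancelʳ-≤ _ _ (u ^ i) {{m^n≢0 u i}} (begin
        ℓ * (u ^ n * y ^ μ) * u ^ i     ≡⟨ ring₁ ℓ (u ^ n) (y ^ μ) (u ^ i) ⟩
        ℓ * (u ^ n * u ^ i * y ^ μ)     ≡⟨ cong (λ z → ℓ * (z * y ^ μ)) (split u) ⟩
        ℓ * (u ^ (3 * μ) * y ^ μ)       ≡⟨ cong (ℓ *_) rescale ⟩
        ℓ * (c ^ (3 * μ) * x ^ μ)       ≡⟨ sym (*-assoc ℓ _ _) ⟩
        ℓ * c ^ (3 * μ) * x ^ μ         ≤⟨ *-monoˡ-≤ (x ^ μ) h ⟩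
        K * s ^ (3 * μ) * x ^ μ         ≡⟨ cong (λ z → K * z * x ^ μ) (sym (split s)) ⟩
        K * (s ^ n * s ^ i) * x ^ μ     ≤⟨ *-monoˡ-≤ (x ^ μ) (*-monoʳ-≤ K (*-monoʳ-≤ (s ^ n) (^-monoˡ-≤ i s≤u))) ⟩
        K * (s ^ n * u ^ i) * x ^ μ     ≡⟨ ring₂ K (s ^ n) (u ^ i) (x ^ μ) ⟩
        K * (s ^ n * x ^ μ) * u ^ i     ∎)
      where
      open ≤-Reasoning
      ring₁ : ∀ l a b t → l * (a * b) * t ≡ l * (a * t * b)
      ring₁ = solve-∀
      ring₂ : ∀ k a t b → k * (a * t) * b ≡ k * (a * b) * t
      ring₂ = solve-∀
      split : ∀ z → z ^ n * z ^ i ≡ z ^ (3 * μ)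
      split z = trans (sym (^-distribˡ-+-* z n i)) (cong (z ^_) eq)
      rescale : u ^ (3 * μ) * y ^ μ ≡ c ^ (3 * μ) * x ^ μ
      rescale = trans (cong (_* y ^ μ) (sym (^-*-assoc u 3 μ))) (trans (sym (^-* (u ^ 3) y μ))
        (trans (cong (_^ μ) scale) (trans (^-* (c ^ 3) x μ) (cong (_* x ^ μ) (^-*-assoc c 3 μ)))))

    -- Either X or its complement may be the smaller; the sum of both orientations bounds either
    -- case and adds up to 2 (x + y) ^ n over all X.
    spread : Subset n → ℕ
    spread X = x ^ ∣ X ∣ * y ^ ∣ ∁ X ∣ + y ^ ∣ X ∣ * x ^ ∣ ∁ X ∣

    -- Multiplying by y ^ b completes y ^ a to y ^ n, which is the same for every X, and leaves x ^
    -- a y ^ b for the binomial sum.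
    trade-complement : ∀ ℓ K a b → a + b ≡ n → n ≤ 3 * a →
      ℓ * c ^ (3 * a) ≤ K * s ^ (3 * a) → ℓ * (u * y) ^ n ≤ K * s ^ n * (x ^ a * y ^ b)
    trade-complement ℓ K a b a+b≡n n≤3a h = begin
      ℓ * (u * y) ^ n                ≡⟨ cong (ℓ *_) (^-* u y n) ⟩
      ℓ * (u ^ n * y ^ n)            ≡⟨ cong (λ z → ℓ * (u ^ n * z)) (trans (cong (y ^_) (sym a+b≡n)) (^-distribˡ-+-* y a b)) ⟩
      ℓ * (u ^ n * (y ^ a * y ^ b))  ≡⟨ ring₁ ℓ (u ^ n) (y ^ a) (y ^ b) ⟩
      ℓ * (u ^ n * y ^ a) * y ^ b    ≤⟨ *-monoˡ-≤ (y ^ b) (trade ℓ K a n≤3a h) ⟩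
      K * (s ^ n * x ^ a) * y ^ b    ≡⟨ ring₂ K (s ^ n) (x ^ a) (y ^ b) ⟩
      K * s ^ n * (x ^ a * y ^ b)    ∎
      where
      open ≤-Reasoning
      ring₁ : ∀ l u a b → l * (u * (a * b)) ≡ l * (u * a) * b
      ring₁ = solve-∀
      ring₂ : ∀ l u a b → l * (u * a) * b ≡ l * u * (a * b)
      ring₂ = solve-∀

    spread-bound : ∀ ℓ K X → Balanced X →
      ℓ * c ^ (3 * smaller X) ≤ K * s ^ (3 * smaller X) →
      ℓ * (u * y) ^ n ≤ K * s ^ n * spread X
    spread-bound ℓ K X (n≤3∣X∣ , 3∣X∣≤2n) h with ⊓-sel ∣ X ∣ ∣ ∁ X ∣
    ... | inj₁ μ≡ = ≤-trans
      (trade-complement ℓ K ∣ X ∣ ∣ ∁ X ∣ (∣X∣+∣∁X∣ X) n≤3∣X∣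
        (subst (λ μ → ℓ * c ^ (3 * μ) ≤ K * s ^ (3 * μ)) μ≡ h))
      (*-monoʳ-≤ (K * s ^ n) (m≤m+n _ _))
    ... | inj₂ μ≡ = ≤-trans
      (trade-complement ℓ K ∣ ∁ X ∣ ∣ X ∣ (trans (+-comm ∣ ∁ X ∣ ∣ X ∣) (∣X∣+∣∁X∣ X)) n≤3∣∁X∣
        (subst (λ μ → ℓ * c ^ (3 * μ) ≤ K * s ^ (3 * μ)) μ≡ h))
      (*-monoʳ-≤ (K * s ^ n) (≤-trans (≤-reflexive (*-comm (x ^ ∣ ∁ X ∣) _)) (m≤n+m _ _)))
      where
      open ≤-Reasoning
      n≤3∣∁X∣ : n ≤ 3 * ∣ ∁ X ∣
      n≤3∣∁X∣ = +-cancelˡ-≤ (3 * ∣ X ∣) n (3 * ∣ ∁ X ∣) (begin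
        3 * ∣ X ∣ + n           ≤⟨ +-monoˡ-≤ n 3∣X∣≤2n ⟩
        2 * n + n               ≡⟨ +-comm (2 * n) n ⟩
        3 * n                   ≡⟨ cong (3 *_) (sym (∣X∣+∣∁X∣ X)) ⟩
        3 * (∣ X ∣ + ∣ ∁ X ∣)   ≡⟨ *-distribˡ-+ 3 ∣ X ∣ ∣ ∁ X ∣ ⟩
        3 * ∣ X ∣ + 3 * ∣ ∁ X ∣ ∎)

    sparse-bound : ∀ k → length (filter (hasSparseCut? n d k) Ω) * (u * y) ^ n ≤
      2 * (c ^ (k + suc o) * length Ω) * (s * (x + y)) ^ n
    sparse-bound k = begin
      length (filter (hasSparseCut? n d k) Ω) * g
        ≤⟨ *-monoˡ-≤ g (union-bound (hasSparseCut? n d k) (sparseCut? n d k) (subsets n) Ω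
             (λ { v (X , sp) → X , ∈-subsets X , sp })) ⟩
      sum (map count (subsets n)) * g
        ≡⟨ *-comm _ g ⟩
      g * sum (map count (subsets n))
        ≡⟨ sym (sum-map-const* count g (subsets n)) ⟩
      sum (map (λ X → g * count X) (subsets n))
        ≤⟨ sum-map-≤ (subsets n) each ⟩
      sum (map (λ X → K * s ^ n * spread X) (subsets n))
        ≡⟨ sum-map-const* spread (K * s ^ n) (subsets n) ⟩
      K * s ^ n * sum (map spread (subsets n))
        ≡⟨ cong (K * s ^ n *_) (trans (sum-+ (subsets n)) (cong₂ _+_ (sum-subsets n x y) (trans (sum-subsets n y x) (cong (_^ n) (+-comm y x))))) ⟩
      K * s ^ n * ((x + y) ^ n + (x + y) ^ n)
        ≡⟨ ring K (s ^ n) ((x + y) ^ n) ⟩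
      2 * K * (s ^ n * (x + y) ^ n)
        ≡⟨ cong (2 * K *_) (sym (^-* s (x + y) n)) ⟩
      2 * K * (s * (x + y)) ^ n ∎
      where
      open ≤-Reasoning
      g = (u * y) ^ n
      K = c ^ (k + suc o) * length Ω
      count : Subset n → ℕ
      count X = length (filter (sparseCut? n d k X) Ω)
      ring : ∀ K a b → K * a * (b + b) ≡ 2 * K * (a * b)
      ring = solve-∀
      sum-+ : ∀ xs → sum (map spread xs) ≡
        sum (map (λ X → x ^ ∣ X ∣ * y ^ ∣ ∁ X ∣) xs) + sum (map (λ X → y ^ ∣ X ∣ * x ^ ∣ ∁ X ∣) xs)
      sum-+ [] = refl
      sum-+ (X ∷ xs) = trans (cong (spread X +_) (sum-+ xs)) (ring₄ (x ^ ∣ X ∣ * y ^ ∣ ∁ X ∣) _ _ _)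
        where
        ring₄ : ∀ a b c d → (a + b) + (c + d) ≡ (a + c) + (b + d)
        ring₄ = solve-∀
      each : ∀ X → g * count X ≤ K * s ^ n * spread X
      each X = by-balance (balanced? X)
        where
        by-balance : Dec (Balanced X) → g * count X ≤ K * s ^ n * spread X
        by-balance (yes bal) = begin
          g * count X ≡⟨ *-comm g (count X) ⟩
          count X * g ≤⟨ *-monoˡ-≤ g (length-filter-mono (sparseCut? n d k X)
            (λ v → cutSize n d X v ≤? k) (λ _ → proj₂) Ω) ⟩
          length (filter (λ v → cutSize n d X v ≤? k) Ω) * g
            ≤⟨ spread-bound (length (filter (λ v → cutSize n d X v ≤? k) Ω)) K X bal (sparse-cuts-bound k X) ⟩
          K * s ^ n * spread X ∎
        by-balance (no ¬bal) = subst (_≤ K * s ^ n * spread X) (sym (trans (cong (g *_) (none Ω)) (*-zeroʳ g))) z≤n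
          where
          none : ∀ vs → length (filter (sparseCut? n d k X) vs) ≡ 0
          none vs = cong length (List.filter-none (sparseCut? n d k X) (All.tabulate {xs = vs} (λ _ p → ¬bal (proj₁ p))))

-- From inequalities in ℕ to rational probabilities

module Rational where

  open import Data.Nat.Base as ℕ using (ℕ; zero; suc)
  import Data.Nat.Properties as ℕ
  open import Data.Integer.Base as ℤ using (+_; -[1+_])
  import Data.Integer.Properties as ℤ
  open import Data.Rational.Base
  open import Data.Rational.Properties
  open import Data.Rational.Unnormalised.Base as ℚᵘ using (mkℚᵘ)
  import Data.Rational.Unnormalised.Properties as ℚᵘ
  open import Relation.Binary.PropositionalEquality

  toℚᵘ-ℕtoℚ : ∀ k → toℚᵘ (ℕtoℚ k) ℚᵘ.≃ mkℚᵘ (+ k) 0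
  toℚᵘ-ℕtoℚ k = toℚᵘ-fromℚᵘ (mkℚᵘ (+ k) 0)

  ℕtoℚ-+ : ∀ a b → ℕtoℚ (a ℕ.+ b) ≡ ℕtoℚ a + ℕtoℚ b
  ℕtoℚ-+ a b = toℚᵘ-injective (begin
    toℚᵘ (ℕtoℚ (a ℕ.+ b))                  ≈⟨ toℚᵘ-ℕtoℚ (a ℕ.+ b) ⟩
    mkℚᵘ (+ (a ℕ.+ b)) 0                   ≈⟨ ℚᵘ.*≡* (cong (ℤ._* + 1) (sym (cong₂ ℤ._+_ (ℤ.*-identityʳ (+ a)) (ℤ.*-identityʳ (+ b))))) ⟩
    mkℚᵘ (+ a) 0 ℚᵘ.+ mkℚᵘ (+ b) 0         ≈⟨ ℚᵘ.+-cong (ℚᵘ.≃-sym (toℚᵘ-ℕtoℚ a)) (ℚᵘ.≃-sym (toℚᵘ-ℕtoℚ b)) ⟩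
    toℚᵘ (ℕtoℚ a) ℚᵘ.+ toℚᵘ (ℕtoℚ b)       ≈⟨ ℚᵘ.≃-sym (toℚᵘ-homo-+ (ℕtoℚ a) (ℕtoℚ b)) ⟩
    toℚᵘ (ℕtoℚ a + ℕtoℚ b)                 ∎)
    where open import Relation.Binary.Reasoning.Setoid ℚᵘ.≃-setoid

  ℕtoℚ-scale-≤ : ∀ D n w → n ℕ.≤ suc D ℕ.* w → (+ 1 / suc D) * ℕtoℚ n ≤ ℕtoℚ w
  ℕtoℚ-scale-≤ D n w n≤ = toℚᵘ-cancel-≤ (begin
    toℚᵘ ((+ 1 / suc D) * ℕtoℚ n)           ≃⟨ toℚᵘ-homo-* (+ 1 / suc D) (ℕtoℚ n) ⟩
    toℚᵘ (+ 1 / suc D) ℚᵘ.* toℚᵘ (ℕtoℚ n)   ≃⟨ ℚᵘ.*-cong (toℚᵘ-fromℚᵘ (mkℚᵘ (+ 1) D)) (toℚᵘ-ℕtoℚ n) ⟩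
    mkℚᵘ (+ 1) D ℚᵘ.* mkℚᵘ (+ n) 0          ≤⟨ ℚᵘ.*≤* core ⟩
    mkℚᵘ (+ w) 0                            ≃⟨ ℚᵘ.≃-sym (toℚᵘ-ℕtoℚ w) ⟩
    toℚᵘ (ℕtoℚ w)                           ∎)
    where
    open ℚᵘ.≤-Reasoning
    core : (+ 1 ℤ.* + n) ℤ.* + 1 ℤ.≤ + w ℤ.* + (suc D ℕ.* 1)
    core = subst₂ ℤ._≤_ (sym (trans (ℤ.*-identityʳ _) (ℤ.*-identityˡ (+ n))))
             (trans (cong +_ (trans (ℕ.*-comm (suc D) w) (cong (w ℕ.*_) (sym (ℕ.*-identityʳ (suc D))))))
               (ℤ.pos-* w (suc D ℕ.* 1)))
             (ℤ.+≤+ n≤)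

  -- A positive ε has numerator at least 1 and is therefore at least 1 / `↧ₙ ε`.
  ≤-scaled : ∀ ε → 0ℚ < ε → ∀ B Ω → B ℕ.* ↧ₙ ε ℕ.≤ Ω → ℕtoℚ B ≤ ε * ℕtoℚ Ω
  ≤-scaled (mkℚ (+ zero) _ _) (*<* (ℤ.+<+ ())) B Ω h
  ≤-scaled (mkℚ -[1+ _ ] _ _) (*<* ()) B Ω h
  ≤-scaled ε@(mkℚ (+ suc a) e _) 0<ε B Ω h = toℚᵘ-cancel-≤ (begin
    toℚᵘ (ℕtoℚ B)                 ≃⟨ toℚᵘ-ℕtoℚ B ⟩
    mkℚᵘ (+ B) 0                  ≤⟨ ℚᵘ.*≤* core ⟩
    toℚᵘ ε ℚᵘ.* mkℚᵘ (+ Ω) 0      ≃⟨ ℚᵘ.*-congˡ {toℚᵘ ε} (ℚᵘ.≃-sym (toℚᵘ-ℕtoℚ Ω)) ⟩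
    toℚᵘ ε ℚᵘ.* toℚᵘ (ℕtoℚ Ω)     ≃⟨ ℚᵘ.≃-sym (toℚᵘ-homo-* ε (ℕtoℚ Ω)) ⟩
    toℚᵘ (ε * ℕtoℚ Ω)             ∎)
    where
    open ℚᵘ.≤-Reasoning
    core : + B ℤ.* + (suc e ℕ.* 1) ℤ.≤ (+ suc a ℤ.* + Ω) ℤ.* + 1
    core = subst₂ ℤ._≤_ (trans (cong (λ z → + (B ℕ.* z)) (sym (ℕ.*-identityʳ (suc e)))) (ℤ.pos-* B (suc e ℕ.* 1)))
             (trans (ℤ.pos-* (suc a) Ω) (sym (ℤ.*-identityʳ _)))
             (ℤ.+≤+ (ℕ.≤-trans h (ℕ.m≤n*m Ω (suc a))))

  complement-bound : ∀ ε → 0ℚ < ε → ∀ S B Ω → S ℕ.+ B ≡ Ω → B ℕ.* ↧ₙ ε ℕ.≤ Ω →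
                     (1ℚ - ε) * ℕtoℚ Ω ≤ ℕtoℚ S
  complement-bound ε 0<ε S B Ω S+B h = begin
    (1ℚ - ε) * ℕtoℚ Ω                   ≡⟨ *-distribʳ-+ (ℕtoℚ Ω) 1ℚ (- ε) ⟩
    1ℚ * ℕtoℚ Ω + - ε * ℕtoℚ Ω          ≡⟨ cong₂ _+_ (trans (*-identityˡ (ℕtoℚ Ω)) (trans (cong ℕtoℚ (sym S+B)) (ℕtoℚ-+ S B))) (sym (neg-distribˡ-* ε (ℕtoℚ Ω))) ⟩
    (ℕtoℚ S + ℕtoℚ B) + - (ε * ℕtoℚ Ω)  ≤⟨ +-monoʳ-≤ (ℕtoℚ S + ℕtoℚ B) (neg-antimono-≤ (≤-scaled ε 0<ε B Ω h)) ⟩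
    (ℕtoℚ S + ℕtoℚ B) + - ℕtoℚ B        ≡⟨ +-assoc (ℕtoℚ S) (ℕtoℚ B) (- ℕtoℚ B) ⟩
    ℕtoℚ S + (ℕtoℚ B + - ℕtoℚ B)        ≡⟨ cong (λ z → ℕtoℚ S + z) (+-inverseʳ (ℕtoℚ B)) ⟩
    ℕtoℚ S + 0ℚ                         ≡⟨ +-identityʳ (ℕtoℚ S) ⟩
    ℕtoℚ S                              ∎
    where open ≤-Reasoning

-- Numerical rates, and the limit

module Asymptotics where

  open Separations
  open Matchings
  open HalfEdges
  open SparseCuts
  open Rational
  open import Data.Nat.Base
  open import Data.Nat.Properties
  open import Data.Nat.DivMod using (_/_; m/n*n≤m; m*n/n≡m; /-monoˡ-≤)
  open import Data.Nat.Divisibility.Core using (divides)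
  open import Data.Nat.ListAction using (sum)
  open import Data.Bool.Base using (true; false; if_then_else_)
  open import Data.Fin.Base using (Fin; quotient)
  open import Data.Fin.Subset using (∣_∣; _∉_)
  open import Data.Vec.Base using (lookup)
  import Data.Vec.Properties as Vec
  open import Data.List.Base as List using (List; []; _∷_; map; length; filter)
  import Data.List.Properties as List
  import Data.List.Relation.Unary.All.Properties as All
  import Data.List.Relation.Unary.All as All
  import Data.List.Relation.Binary.Sublist.Setoid.Properties as Sublist
  open import Data.Product.Base using (∃-syntax; _×_; _,_; proj₁)
  open import Data.Empty using (⊥-elim)
  open import Data.Unit.Base using (tt)
  open import Data.Rational.Base as ℚ using (ℚ; 0ℚ; 1ℚ; ↧ₙ_)
  import Data.Rational.Properties as ℚ
  import Data.Integer.Base as ℤ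
  open import Relation.Binary.PropositionalEquality
  open import Relation.Nullary.Decidable using (Dec; yes; no; ¬?)
  open import Relation.Nullary.Negation using (¬_)
  open import Data.Nat.Tactic.RingSolver using (solve-∀)

  -- Bernoulli's inequality (28/27) ^ r ≥ 1 + r/27 with denominators cleared. Linear decay already
  -- gives the limit, and with an explicit threshold for n.
  linear-decay : ∀ f g → 28 * f ≤ 27 * g → ∀ r → (27 + r) * f ^ r ≤ 27 * g ^ r
  linear-decay f g h zero    = ≤-refl
  linear-decay f g h (suc r) = begin
    (27 + suc r) * (f * f ^ r)         ≡⟨ ring₁ f r (f ^ r) ⟩
    (28 * f + r * f) * f ^ r           ≤⟨ *-monoˡ-≤ (f ^ r) (+-mono-≤ h (*-monoʳ-≤ r f≤g)) ⟩
    (27 * g + r * g) * f ^ r           ≡⟨ ring₂ g r (f ^ r) ⟩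
    g * ((27 + r) * f ^ r)             ≤⟨ *-monoʳ-≤ g (linear-decay f g h r) ⟩
    g * (27 * g ^ r)                   ≡⟨ ring₃ g (g ^ r) ⟩
    27 * (g * g ^ r)                   ∎
    where
    open ≤-Reasoning
    f≤g : f ≤ g
    f≤g = *-cancelˡ-≤ 27 (≤-trans (*-monoˡ-≤ f (n≤1+n 27)) h)
    ring₁ : ∀ f r t → (27 + suc r) * (f * t) ≡ (28 * f + r * f) * t
    ring₁ = solve-∀
    ring₂ : ∀ g r t → (27 * g + r * g) * t ≡ g * ((27 + r) * t)
    ring₂ = solve-∀
    ring₃ : ∀ g t → g * (27 * t) ≡ 27 * (g * t)
    ring₃ = solve-∀

  -- The factor c ^ k is absorbed by the first 150 k of the n exponents.
  absorb : ∀ c f g → .{{_ : NonZero g}} → c * f ^ 150 ≤ g ^ 150 → 28 * f ≤ 27 * g →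
    ∀ B Ω t k r → B * g ^ (150 * k + r) ≤ 2 * (c ^ (k + t) * Ω) * f ^ (150 * k + r) →
    B * r ≤ 54 * c ^ t * Ω
  absorb c f g hc h B Ω t k r hB =
    *-cancelʳ-≤ _ _ (G * g ^ r) {{m*n≢0 G (g ^ r) {{m^n≢0 g (150 * k)}} {{m^n≢0 g r}}}} (begin
      B * r * (G * g ^ r)                               ≡⟨ cong (B * r *_) (sym (^-distribˡ-+-* g (150 * k) r)) ⟩
      B * r * g ^ (150 * k + r)                         ≡⟨ ring₁ B r (g ^ (150 * k + r)) ⟩
      r * (B * g ^ (150 * k + r))                       ≤⟨ *-monoʳ-≤ r hB ⟩
      r * (2 * (c ^ (k + t) * Ω) * f ^ (150 * k + r))   ≡⟨ cong₂ (λ x y → r * (2 * (x * Ω) * y)) (^-distribˡ-+-* c k t) (^-distribˡ-+-* f (150 * k) r) ⟩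
      r * (2 * (c ^ k * c ^ t * Ω) * (f ^ (150 * k) * f ^ r)) ≡⟨ ring₂ r (c ^ k) (c ^ t) Ω (f ^ (150 * k)) (f ^ r) ⟩
      2 * c ^ t * Ω * (c ^ k * f ^ (150 * k)) * (r * f ^ r)
      ≤⟨ *-mono-≤ (*-monoʳ-≤ (2 * c ^ t * Ω) powers)
           (≤-trans (*-monoˡ-≤ (f ^ r) (m≤n+m r 27)) (linear-decay f g h r)) ⟩
      2 * c ^ t * Ω * G * (27 * g ^ r)                  ≡⟨ ring₃ (c ^ t) Ω G (g ^ r) ⟩
      54 * c ^ t * Ω * (G * g ^ r)                      ∎)
    where
    open ≤-Reasoning
    G = g ^ (150 * k)
    powers : c ^ k * f ^ (150 * k) ≤ G
    powers = begin
      c ^ k * f ^ (150 * k)    ≡⟨ cong (c ^ k *_) (sym (^-*-assoc f 150 k)) ⟩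
      c ^ k * (f ^ 150) ^ k    ≡⟨ sym (^-* c (f ^ 150) k) ⟩
      (c * f ^ 150) ^ k        ≤⟨ ^-monoˡ-≤ k hc ⟩
      (g ^ 150) ^ k            ≡⟨ ^-*-assoc g 150 k ⟩
      G                        ∎
    ring₁ : ∀ b r t → b * r * t ≡ r * (b * t)
    ring₁ = solve-∀
    ring₂ : ∀ r ck ct o F f → r * (2 * (ck * ct * o) * (F * f)) ≡ 2 * ct * o * (ck * F) * (r * f)
    ring₂ = solve-∀
    ring₃ : ∀ ct o G g → 2 * ct * o * G * (27 * g) ≡ 54 * ct * o * (G * g)
    ring₃ = solve-∀

  -- With μ = min(|X|, n − |X|) ≥ n/3, the factor (s / c) ^ (3 μ) is at most
  -- (s / u) ^ n (x / y) ^ μ, where u < c makes the sum over all X converge.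
  -- The values are such that s / c exceeds 1/2 slightly and that the
  -- resulting base s (x + y) / (u y) = 0.9639 is below 1.
  record Rates : Set where
    field
      c s o u x y     : ℕ
      1≤c             : 1 ≤ c
      1≤s             : 1 ≤ s
      s≤c             : s ≤ c
      s≤u             : s ≤ u
      1≤y             : 1 ≤ y
      balanced        : ∀ k → k * c + suc k ≤ s * (k + suc k)
      nearly-balanced : ∀ q → o ≤ q → suc q * c + q ≤ s * (suc q + q)
      scale           : u ^ 3 * y ≡ c ^ 3 * x
      absorbs         : c * (s * (x + y)) ^ 150 ≤ (u * y) ^ 150
      decays          : 28 * (s * (x + y)) ≤ 27 * (u * y)

  -- For c = 2 t and s = t + 1 the rate s/c is 1/2 + 1/c, and the inequality holds with slack k + t.
  balanced-step : ∀ t k → k * (t + t) + suc k ≤ suc t * (k + suc k)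
  balanced-step t k = subst (k * (t + t) + suc k ≤_) (ring t k) (m≤m+n _ (k + t))
    where
    ring : ∀ t k → k * (t + t) + suc k + (k + t) ≡ suc t * (k + suc k)
    ring = solve-∀

  -- The slack is exactly q + 1 - t, so t = 50 calls for the reserve o = 49.
  nearly-balanced-step : ∀ t q → t ≤ suc q → suc q * (t + t) + q ≤ suc t * (suc q + q)
  nearly-balanced-step t q t≤1+q = +-cancelʳ-≤ t _ _
    (subst (suc q * (t + t) + q + t ≤_) (ring t q) (+-monoʳ-≤ (suc q * (t + t) + q) t≤1+q))
    where
    ring : ∀ t q → suc q * (t + t) + q + suc q ≡ suc t * (suc q + q) + t
    ring = solve-∀

  -- Abstract, so that conversion checking never unfolds the large powers.
  abstract
    rates : Rates
    rates = record
      { c = 100 ; s = 51 ; o = 49 ; u = 80 ; x = 64 ; y = 125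
      ; 1≤c = ≤ᵇ⇒≤ 1 100 tt ; 1≤s = ≤ᵇ⇒≤ 1 51 tt ; s≤c = ≤ᵇ⇒≤ 51 100 tt ; s≤u = ≤ᵇ⇒≤ 51 80 tt
      ; 1≤y = ≤ᵇ⇒≤ 1 125 tt
      ; balanced = balanced-step 50 ; nearly-balanced = λ q 49≤q → nearly-balanced-step 50 q (s≤s 49≤q)
      -- The cube of 80/100 is 64/125. Moreover 9639 = 51 (64 + 125) and 10000 = 80 · 125, and the
      -- 150th power of 0.9639 is about 0.004, below 1/100.
      ; scale = ≡ᵇ⇒≡ (80 ^ 3 * 125) (100 ^ 3 * 64) tt
      ; absorbs = ≤ᵇ⇒≤ (100 * 9639 ^ 150) (10000 ^ 150) tt
      ; decays = ≤ᵇ⇒≤ (28 * 9639) (27 * 10000) tt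
      }

  open Rates rates using (c; s; o; u; x; y)

  instance
    y≢0 : NonZero y
    y≢0 = >-nonZero (Rates.1≤y rates)
    u≢0 : NonZero u
    u≢0 = >-nonZero (≤-trans (Rates.1≤s rates) (Rates.s≤u rates))
    c≢0 : NonZero c
    c≢0 = >-nonZero (Rates.1≤c rates)

  few-sparse : ∀ n d N → 3 ≤ d → n * d ≡ double N → ∀ k r → n ≡ 150 * k + r →
    length (filter (hasSparseCut? n d k) (matchingVecs (n * d))) * r ≤
      54 * c ^ suc o * length (matchingVecs (n * d))
  few-sparse n d N 3≤d even k r n≡ =
    absorb c (s * (x + y)) (u * y) {{m*n≢0 u y}} absorbs decays B size (suc o) k r
      (subst (λ e → B * (u * y) ^ e ≤ 2 * (c ^ (k + suc o) * size) * (s * (x + y)) ^ e) n≡ (sparse-bound k))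
    where
    open Rates rates hiding (c; s; o; u; x; y)
    B = length (filter (hasSparseCut? n d k) (matchingVecs (n * d)))
    size = length (matchingVecs (n * d))
    open UnionBound n d N 3≤d even c s o u x y 1≤c 1≤s s≤c s≤u balanced nearly-balanced scale
      using (sparse-bound)

  module _ {n d : ℕ} (M : PerfectMatching (n * d)) where

    private G = configGraph n d M

    -- A crossing pair is charged to its half-edge in X. The vertex of that half-edge has a
    -- neighbour outside X and so belongs to S, whose vertices carry d half-edges each.
    separation⇒sparseCut : ∀ {s k} → s * d ≤ k → Separation G s → ∃[ X ] SparseCut n d k X (proj₁ M)
    separation⇒sparseCut {s} {k} sd≤k (X , S , lower , upper , ∣S∣≤s , sep) = X , (lower , upper) , (begin
      cutSize n d X (proj₁ M)
        ≤⟨ sum-map-≤ (halfEdges n d) (λ h → at (quotient d h) (quotient d (partner M h)) (adjacent h)) ⟩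
      sum (map (λ h → g (quotient d h)) (halfEdges n d))
        ≡⟨ trans (sum-halfEdges n d g) (cong (_* d) (sum-tabulate-left S)) ⟩
      ∣ S ∣ * d
        ≤⟨ ≤-trans (*-monoˡ-≤ d ∣S∣≤s) sd≤k ⟩
      k ∎)
      where
      open ≤-Reasoning
      g : Fin n → ℕ
      g v = if lookup S v then 1 else 0
      adjacent : ∀ h → quotient d h ≢ quotient d (partner M h) → Adj G (quotient d h) (quotient d (partner M h))
      adjacent h u≢v = u≢v , h , refl , refl
      at : ∀ u v → (u ≢ v → Adj G u v) → crosses (vertexSide n d X) (lookup X u) (lookup X v) ≤ g u
      at u v adj with lookup X u in Xu | lookup X v in Xv | lookup S u in Su
      ... | true  | true  | _     = z≤n
      ... | false | _     | _     = z≤n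
      ... | true  | false | true  = ≤-refl
      ... | true  | false | false = ⊥-elim (false≢true
          (trans (sym Xv) (Vec.[]=⇒lookup (sep u v (Vec.lookup⇒[]= u X Xu) u∉S (adj u≢v)))))
        where
        false≢true : false ≢ true
        false≢true ()
        u∉S : u ∉ S
        u∉S u∈S = false≢true (trans (sym Su) (Vec.[]=⇒lookup u∈S))
        u≢v : u ≢ v
        u≢v refl = false≢true (trans (sym Xv) Xu)

  module _ {n d : ℕ} (M : PerfectMatching (n * d)) (0<n : 0 < n) (3≤d : 3 ≤ d)
           (dense : ¬ (∃[ X ] SparseCut n d (n / 300) X (proj₁ M))) where

    private
      G = configGraph n d M
      -- 600 is twice the 300 of the cut size n / 300. The spare factor 2 absorbs the `suc` in the
      -- bag size `suc (width D)` as soon as 600 d ≤ n.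
      no-separation : ∀ s → 600 * d * s ≤ 2 * n → (3 * s < n → Separation G s) → ∀ {A : Set} → A
      no-separation s small sep = ⊥-elim (dense (separation⇒sparseCut M sd≤n/300 (sep (triple s 300sd≤n))))
        where
        open ≤-Reasoning
        300sd≤n : s * d * 300 ≤ n
        300sd≤n = *-cancelˡ-≤ 2 (≤-trans (≤-reflexive (ring 300 s d)) small)
          where
          ring : ∀ a s d → 2 * (s * d * a) ≡ (2 * a) * d * s
          ring = solve-∀
        sd≤n/300 : s * d ≤ n / 300
        sd≤n/300 = subst (_≤ n / 300) (m*n/n≡m (s * d) 300) (/-monoˡ-≤ 300 300sd≤n)
        triple : ∀ s → s * d * 300 ≤ n → 3 * s < n
        triple zero    _ = 0<n
        triple (suc s) h = begin-strict
          3 * suc s          <⟨ *-monoˡ-< (suc s) {3} {300} (≤ᵇ⇒≤ _ _ tt) ⟩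
          300 * suc s        ≡⟨ *-comm 300 (suc s) ⟩
          suc s * 300        ≤⟨ *-monoˡ-≤ 300 (m≤m*n (suc s) d {{>-nonZero (≤-trans (s≤s z≤n) 3≤d)}}) ⟩
          suc s * d * 300    ≤⟨ h ⟩
          n                  ∎

    linear-treewidth : ∀ D′ → suc D′ ≡ 600 * d → 600 * d ≤ n → tw[ G ]≥ ((ℤ.+ 1 ℚ./ suc D′) ℚ.* ℕtoℚ n)
    linear-treewidth D′ eq 600d≤n D with n ≤? 600 * d * width D
    ... | yes n≤ = ℕtoℚ-scale-≤ D′ n (width D) (subst (λ z → n ≤ z * width D) (sym eq) n≤)
    ... | no  n≰ = no-separation (suc (width D))
      (begin
        600 * d * suc (width D)        ≡⟨ *-suc (600 * d) (width D) ⟩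
        600 * d + 600 * d * width D    ≤⟨ +-mono-≤ 600d≤n (<⇒≤ (≰⇒> n≰)) ⟩
        n + n                          ≡⟨ cong (n +_) (sym (+-identityʳ n)) ⟩
        2 * n                          ∎)
      (treewidth-separation G 0<n D)
      where open ≤-Reasoning

    linear-treedepth : ∀ D′ → suc D′ ≡ 600 * d → td[ G ]≥ ((ℤ.+ 1 ℚ./ suc D′) ℚ.* ℕtoℚ n)
    linear-treedepth D′ eq F G⊆F with n ≤? 600 * d * height F
    ... | yes n≤ = ℕtoℚ-scale-≤ D′ n (height F) (subst (λ z → n ≤ z * height F) (sym eq) n≤)
    ... | no  n≰ = no-separation (height F) (≤-trans (<⇒≤ (≰⇒> n≰)) (m≤m+n n _))
      (treedepth-separation G 0<n F G⊆F)

  length-filter-¬ : ∀ {A : Set} {P : A → Set} (P? : ∀ x → Dec (P x)) (xs : List A) →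
    length (filter (λ x → ¬? (P? x)) xs) + length (filter P? xs) ≡ length xs
  length-filter-¬ P? [] = refl
  length-filter-¬ P? (x ∷ xs) with P? x
  ... | yes _ = trans (+-suc _ _) (cong suc (length-filter-¬ P? xs))
  ... | no  _ = cong suc (length-filter-¬ P? xs)

  linear-aas : ∀ d → 3 ≤ d → ∃[ η ] (0ℚ ℚ.< η ×
    AAS d (λ n G → tw[ G ]≥ (η ℚ.* ℕtoℚ n) × td[ G ]≥ (η ℚ.* ℕtoℚ n)))
  linear-aas d@(suc _) 3≤d = ℤ.+ 1 ℚ./ suc D′ , ℚ.positive⁻¹ (ℤ.+ 1 ℚ./ suc D′) {{ℚ.normalize-pos 1 (suc D′)}} , aas
    where
    D′ = pred (600 * d)
    D′≡ : suc D′ ≡ 600 * d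
    D′≡ = suc-pred (600 * d)

    aas : AAS d (λ n G → tw[ G ]≥ ((ℤ.+ 1 ℚ./ suc D′) ℚ.* ℕtoℚ n) × td[ G ]≥ ((ℤ.+ 1 ℚ./ suc D′) ℚ.* ℕtoℚ n))
    aas ε 0<ε = N₀ , λ { n N₀≤n (divides q dn≡) → likely n N₀≤n q (trans (*-comm n d) dn≡) }
      where
      C = 54 * c ^ suc o
      -- The first summand serves the tree-width bound. The second yields `C * ↧ₙ ε ≤ r`, because r
      -- is at least n/2.
      N₀ = 600 * d + 2 * (C * ↧ₙ ε)

      likely : ∀ n → N₀ ≤ n → ∀ q → n * d ≡ q * 2 → ProbAtLeast (perfectMatchings (n * d))
        (λ M → tw[ configGraph n d M ]≥ ((ℤ.+ 1 ℚ./ suc D′) ℚ.* ℕtoℚ n) ×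
               td[ configGraph n d M ]≥ ((ℤ.+ 1 ℚ./ suc D′) ℚ.* ℕtoℚ n)) (1ℚ ℚ.- ε)
      likely n N₀≤n q nd≡ = filter (λ M → ¬? (sparse? M)) Ω
        , Sublist.filter-⊆ (setoid _) (λ M → ¬? (sparse? M)) Ω
        , All.map (λ {M} dense → linear-treewidth M 0<n 3≤d dense D′ D′≡ 600d≤n
                               , linear-treedepth M 0<n 3≤d dense D′ D′≡)
            (All.all-filter (λ M → ¬? (sparse? M)) Ω)
        , complement-bound ε 0<ε _ B (length Ω) (length-filter-¬ sparse? Ω) B-small
        where
        Ω = perfectMatchings (n * d)
        -- Of the n exponents, 150 k ≤ n/2 absorb c ^ k, and the remaining r make the probability
        -- small.
        k = n / 300
        r = n ∸ 150 * k
        sparse? : ∀ M → Dec (∃[ X ] SparseCut n d k X (proj₁ M))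
        sparse? M = hasSparseCut? n d k (proj₁ M)
        B = length (filter sparse? Ω)
        600d≤n : 600 * d ≤ n
        600d≤n = ≤-trans (m≤m+n _ _) N₀≤n
        0<n : 0 < n
        0<n = ≤-trans (≤-trans (s≤s z≤n) (≤-reflexive D′≡)) 600d≤n
        2*150k≤n : 2 * (150 * k) ≤ n
        2*150k≤n = ≤-trans (≤-reflexive (ring 150 k)) (m/n*n≤m n 300)
          where
          ring : ∀ a k → 2 * (a * k) ≡ k * (2 * a)
          ring = solve-∀
        split : n ≡ 150 * k + r
        split = sym (m+[n∸m]≡n (≤-trans (m≤m+n (150 * k) _) 2*150k≤n))
        C*den≤r : C * ↧ₙ ε ≤ r
        C*den≤r = *-cancelˡ-≤ 2 (+-cancelˡ-≤ (2 * (150 * k)) _ _ (begin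
          2 * (150 * k) + 2 * (C * ↧ₙ ε)  ≤⟨ +-mono-≤ 2*150k≤n (≤-trans (m≤n+m _ (600 * d)) N₀≤n) ⟩
          n + n                           ≡⟨ cong (n +_) (sym (+-identityʳ n)) ⟩
          2 * n                           ≡⟨ cong (2 *_) split ⟩
          2 * (150 * k + r)               ≡⟨ *-distribˡ-+ 2 (150 * k) r ⟩
          2 * (150 * k) + 2 * r           ∎))
          where open ≤-Reasoning
        B-small : B * ↧ₙ ε ≤ length Ω
        B-small = *-cancelˡ-≤ C {{m*n≢0 54 (c ^ suc o) {{_}} {{m^n≢0 c (suc o)}}}} (begin
          C * (B * ↧ₙ ε)      ≡⟨ ring C B (↧ₙ ε) ⟩
          B * (C * ↧ₙ ε)      ≤⟨ *-monoʳ-≤ B C*den≤r ⟩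
          B * r               ≡⟨ cong (_* r) (length-filter-map (hasSparseCut? n d k) proj₁ Ω) ⟩
          length (filter (hasSparseCut? n d k) (matchingVecs (n * d))) * r
                              ≤⟨ few-sparse n d q 3≤d (trans nd≡ (double≡ q)) k r split ⟩
          C * length (matchingVecs (n * d)) ≡⟨ cong (C *_) (List.length-map proj₁ Ω) ⟩
          C * length Ω        ∎)
          where
          open ≤-Reasoning
          ring : ∀ c b e → c * (b * e) ≡ b * (c * e)
          ring = solve-∀
          double≡ : ∀ q → q * 2 ≡ double q
          double≡ zero    = refl
          double≡ (suc q) = cong (λ z → suc (suc z)) (double≡ q)

open import Data.Nat.Base as ℕ using (ℕ)
open import Data.Rational.Base using (ℚ; 0ℚ; _<_; _*_)
open import Data.Product.Base using (_×_; _,_; ∃-syntax)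

corollary4p6 : ∀ (d : ℕ) → 3 ℕ.≤ d →
    (∃[ η ] (0ℚ < η ×
    AAS d (λ n G → tw[ G ]≥ (η * ℕtoℚ n) × td[ G ]≥ (η * ℕtoℚ n))))
    × (∀ n (M : PerfectMatching (n ℕ.* d)) →
    tw[ configGraph n d M ]≤ n × td[ configGraph n d M ]≤ n)
corollary4p6 d 3≤d = Asymptotics.linear-aas d 3≤d
  , λ n M → Separations.treewidth≤ (configGraph n d M) , Separations.treedepth≤ (configGraph n d M)
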